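{- For every integer $r$ with $1\le r\le 7$ (in particular for $r\in\{2,3,4,5,6,7\}$), $R(P;r)=r+6$.
   Context: All hypergraphs are 3-uniform (3-graphs). $P$ denotes the loose 3-uniform path of length 3: the 3-graph on 7 vertices $a,b,c,d,e,f,g$ with the 3 edges $\{a,b,c\},\{c,d,e\},\{e,f,g\}$. $K^3_n$ is the complete 3-graph on $n$ vertices (all 3-subsets are edges). For an integer $r\ge 1$, the Ramsey number $R(P;r)$ is the least integer $n$ such that every coloring of the edges of $K^3_n$ with $r$ colors contains a monochromatic copy of $P$. -}

module Defs where

open import Level using (0ℓ; suc)
open import Data.Nat.Base using (ℕ; _≤_)
open import Data.Fin.Base using (Fin)
open import Data.Fin.Patterns using (0F; 1F; 2F; 3F; 4F; 5F; 6F)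
open import Data.Fin.Subset using (Subset; ⁅_⁆; _∪_; ∣_∣; _∈_)
open import Data.List.Base using (_∷_; [])
import Data.List.Membership.Propositional as List
open import Data.Product.Base using (Σ-syntax; ∃-syntax; _×_; _,_; proj₁)
open import Function.Bundles using (_⇔_)
open import Function.Definitions using (Injective)
open import Relation.Binary.PropositionalEquality using (_≡_; refl)
open import Relation.Unary using (Pred)

Triple : ℕ → Set
Triple n = Σ[ e ∈ Subset n ] ∣ e ∣ ≡ 3

-- A 3-graph on the vertex set Fin n, given by its set of edges.
3-Graph : ℕ → Set (suc 0ℓ)
3-Graph n = Pred (Triple n) 0ℓ

-- The loose path, with the vertices a, …, g taken to be 0F, …, 6F.
P : 3-Graph 7
P e = e List.∈ (abc ∷ cde ∷ efg ∷ [])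
  where
  abc cde efg : Triple 7
  abc = ⁅ 0F ⁆ ∪ ⁅ 1F ⁆ ∪ ⁅ 2F ⁆ , refl
  cde = ⁅ 2F ⁆ ∪ ⁅ 3F ⁆ ∪ ⁅ 4F ⁆ , refl
  efg = ⁅ 4F ⁆ ∪ ⁅ 5F ⁆ ∪ ⁅ 6F ⁆ , refl

-- T is the image of S under f.
IsImage : ∀ {m n} → (Fin m → Fin n) → Subset m → Subset n → Set
IsImage f S T = ∀ y → (y ∈ T) ⇔ (∃[ x ] x ∈ S × f x ≡ y)

-- H contains a copy of G, as a not necessarily induced subgraph.
_ContainsCopyOf_ : ∀ {n m} → 3-Graph n → 3-Graph m → Set
_ContainsCopyOf_ {n} {m} H G =
  Σ[ f ∈ (Fin m → Fin n) ] Injective _≡_ _≡_ f ×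
    (∀ e → G e → ∃[ e′ ] H e′ × IsImage f (proj₁ e) (proj₁ e′))

-- Colourings of the edges of the complete 3-graph on Fin n, that is, of
-- all triples.
Colouring : ℕ → ℕ → Set
Colouring n r = Triple n → Fin r

ColourClass : ∀ {n r} → Colouring n r → Fin r → 3-Graph n
ColourClass χ c e = χ e ≡ c

HasMonochromatic : ∀ {m n r} → 3-Graph m → Colouring n r → Set
HasMonochromatic G χ = ∃[ c ] (ColourClass χ c ContainsCopyOf G)

Forces : ∀ {m} → 3-Graph m → ℕ → ℕ → Set
Forces G r n = (χ : Colouring n r) → HasMonochromatic G χ

-- N = R(G; r).
IsRamseyNumber : ∀ {m} → 3-Graph m → ℕ → ℕ → Set
IsRamseyNumber G r N = Forces G r N × (∀ n → Forces G r n → N ≤ n)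

{-# OPTIONS --safe #-}

-- Upper bound, by induction on r.  If all edges of some colour contain a vertex x, delete x
-- together with that colour.  Otherwise no class is a star, and it is enough that a P-free
-- 3-graph on n = r + 6 vertices which is not a star has at most B edges, where r B < C(n,3):
-- B = 34, 27, 27, 29, 32, 40 does for n = 7, …, 11, 13.  This is proved by a search that decides
-- triple by triple whether it is an edge, discards the triples completing a path, and treats a
-- whole orbit at once under the transpositions of vertices that preserve the current state.
--
-- For n = 12 the bound is B = 35, with the exception of subgraphs of two disjoint K_6, which may
-- have 40 edges.  Given one such exceptional colour, every other exceptional one has at most 36
-- edges across its halves, so that one ordinary colour leaves only 40 + 35 + 4 · 36 < C(12,3).
-- If all six colours are exceptional, fix a vertex v.  A vertex x ≠ v shares its half with v in
-- at least three colours, because each such colour accounts for 4 of the 10 triples v x y; but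
-- 11 · 3 > 6 · 5.
--
-- Lower bound: on r + 5 vertices, colour a triple by its least vertex, merging the last colours.
module Submission where

open import Defs
open import Data.Bool.Base using (Bool; true; false; T; _∧_; _∨_; if_then_else_)
open import Data.Bool.ListAction using (all)
open import Data.Bool.Properties using (T-∧; T-∨; T-≡)
open import Data.Empty using (⊥)
open import Data.Fin.Base using (Fin; zero; suc; toℕ; fromℕ<; punchIn; punchOut)
open import Data.Fin.Patterns using (0F; 1F; 2F; 3F; 4F; 5F; 6F)
open import Data.Fin.Properties as Fin using (toℕ-injective; toℕ-fromℕ<; toℕ<n; injective⇒≤)
open import Data.Fin.Subset
  using (Subset; ⁅_⁆; _∪_; ∣_∣; inside; outside) renaming (_∈_ to _∈ˢ_; ⊥ to ∅)
open import Data.Fin.Subset.Properties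
  using (∪-comm; ∪-assoc; ∪-idem; ∪-identityˡ; ∪-identityʳ; ∣⁅x⁆∣≡1; x∈⁅x⁆; x∈⁅y⁆⇒x≡y; x∈p∪q⁺;
         x∈p∪q⁻; anySubset?) renaming (_∈?_ to _∈ˢ?_)
open import Data.List.Base
  using (List; []; _∷_; _++_; map; filter; length; upTo; applyUpTo; allFin; concatMap;
         cartesianProduct)
open import Data.List.Membership.Propositional using (_∈_; find; lose)
open import Data.List.Membership.Propositional.Properties
  using (∈-filter⁺; ∈-map⁺; ∈-map⁻; ∈-upTo⁺; ∈-upTo⁻; ∈-applyUpTo⁻; ∈-++⁺ˡ; ∈-++⁺ʳ; ∈-++⁻;
         ∈-allFin; ∈-concatMap⁺)
open import Data.List.Properties
  using (length-map; length-++; length-tabulate; filter-accept; filter-reject; filter-notAll;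
         filter-some; filter-++)
open import Data.List.Relation.Unary.All as All using (All; []; _∷_; all?)
open import Data.List.Relation.Unary.All.Properties using (all⁺; all-filter)
open import Data.List.Relation.Unary.AllPairs using ([]; _∷_)
open import Data.List.Relation.Unary.Any as Any using (Any; here; there; any?)
open import Data.List.Relation.Unary.Unique.Propositional using (Unique)
open import Data.List.Relation.Unary.Unique.Propositional.Properties using (upTo⁺; applyUpTo⁺₁)
open import Data.Nat
  using (ℕ; zero; suc; _+_; _*_; _∸_; _^_; _⊓_; _≡ᵇ_; _<ᵇ_; _≤ᵇ_; _≤_; _<_; z≤n; s≤s)
open import Data.Nat.Properties
open import Data.List.Membership.DecPropositional _≟_ using (_∈?_)
open import Data.List.Relation.Unary.Unique.DecPropositional _≟_ using (unique?)
open import Data.Product.Base using (_×_; _,_; proj₁; proj₂; ∃; ∃-syntax; Σ-syntax)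
open import Data.Sum.Base as Sum using (_⊎_; inj₁; inj₂)
open import Data.Vec.Base as Vec using (Vec; []; _∷_; lookup; insertAt; here; there)
open import Data.Vec.Properties using (insertAt-lookup; insertAt-punchIn; []=⇒lookup; lookup⇒[]=)
open import Data.Vec.Relation.Unary.All using ([]; _∷_)
open import Data.Vec.Relation.Unary.AllPairs using ([]; _∷_; allPairs?)
import Data.Vec.Relation.Unary.Unique.Propositional as Vec
open import Data.Vec.Relation.Unary.Unique.Propositional.Properties using (lookup-injective)
open import Function.Base using (_∘_; id)
open import Function.Bundles using (Equivalence; mk⇔)
open import Relation.Binary.PropositionalEquality
  using (_≡_; _≢_; refl; sym; trans; cong; cong₂; subst; subst₂; ≢-sym)
open import Relation.Nullary.Decidable
  using (Dec; yes; no; does; True; T?; ¬?; _×-dec_; _⊎-dec_; map′; toWitness; toWitnessFalse;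
         from-yes; from-no; dec-true; dec-false)
open import Relation.Nullary.Negation using (¬_; contradiction)

-- Triples up to reordering

-- Vertices are natural numbers, which evaluate fast.  A 3-graph is a predicate on Tri that is
-- invariant under reordering; only its triples below n matter.
data Tri : Set where
  tri : ℕ → ℕ → ℕ → Tri

mapᵗ : (ℕ → ℕ) → Tri → Tri
mapᵗ f (tri a b c) = tri (f a) (f b) (f c)

infix 4 _∈ᵗ_ _∈ᵗ?_ _≡ᵗ_ _∈ᵇ_ _∼_ _⊑_ _⊆ᵗ_ _⊆ᵗ?_

_∈ᵗ_ : ℕ → Tri → Set
x ∈ᵗ tri a b c = x ≡ a ⊎ x ≡ b ⊎ x ≡ c

_∈ᵗ?_ : ∀ x t → Dec (x ∈ᵗ t)
x ∈ᵗ? tri a b c = x ≟ a ⊎-dec x ≟ b ⊎-dec x ≟ c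

_≡ᵗ_ : Tri → Tri → Bool
tri a b c ≡ᵗ tri a′ b′ c′ = (a ≡ᵇ a′) ∧ (b ≡ᵇ b′) ∧ (c ≡ᵇ c′)

_∈ᵇ_ : Tri → List Tri → Bool
t ∈ᵇ []       = false
t ∈ᵇ (u ∷ us) = (t ≡ᵗ u) ∨ (t ∈ᵇ us)

-- Generated by the two adjacent swaps, which yield all six orders of a triple. Symmetry can be
-- derived because both generators are their own inverses.
data _∼_ : Tri → Tri → Set where
  ∼-refl  : ∀ {t} → t ∼ t
  ∼-trans : ∀ {t u v} → t ∼ u → u ∼ v → t ∼ v
  flip₁₂  : ∀ {a b c} → tri a b c ∼ tri b a c
  flip₂₃  : ∀ {a b c} → tri a b c ∼ tri a c b

∼-sym : ∀ {t u} → t ∼ u → u ∼ t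
∼-sym ∼-refl        = ∼-refl
∼-sym (∼-trans p q) = ∼-trans (∼-sym q) (∼-sym p)
∼-sym flip₁₂        = flip₁₂
∼-sym flip₂₃        = flip₂₃

∼-map : ∀ {t u} f → t ∼ u → mapᵗ f t ∼ mapᵗ f u
∼-map f ∼-refl        = ∼-refl
∼-map f (∼-trans p q) = ∼-trans (∼-map f p) (∼-map f q)
∼-map f flip₁₂        = flip₁₂
∼-map f flip₂₃        = flip₂₃

∈ᵗ-resp-∼ : ∀ {t u x} → t ∼ u → x ∈ᵗ t → x ∈ᵗ u
∈ᵗ-resp-∼ ∼-refl        x∈t                = x∈t
∈ᵗ-resp-∼ (∼-trans p q) x∈t                = ∈ᵗ-resp-∼ q (∈ᵗ-resp-∼ p x∈t)
∈ᵗ-resp-∼ flip₁₂        (inj₁ x≡a)         = inj₂ (inj₁ x≡a)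
∈ᵗ-resp-∼ flip₁₂        (inj₂ (inj₁ x≡b))  = inj₁ x≡b
∈ᵗ-resp-∼ flip₁₂        (inj₂ (inj₂ x≡c))  = inj₂ (inj₂ x≡c)
∈ᵗ-resp-∼ flip₂₃        (inj₁ x≡a)         = inj₁ x≡a
∈ᵗ-resp-∼ flip₂₃        (inj₂ (inj₁ x≡b))  = inj₂ (inj₂ x≡b)
∈ᵗ-resp-∼ flip₂₃        (inj₂ (inj₂ x≡c))  = inj₂ (inj₁ x≡c)

∈ᵗ-map⁺ : ∀ {x} f t → x ∈ᵗ t → f x ∈ᵗ mapᵗ f t
∈ᵗ-map⁺ f (tri a b c) = Sum.map (cong f) (Sum.map (cong f) (cong f))

-- A bubble sort. Candidates are listed with increasing entries, so images are brought to this form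
-- before the syntactic test `_∈ᵇ_`.
sort₁₂ sort₂₃ sort : Tri → Tri
sort₁₂ (tri a b c) = if b <ᵇ a then tri b a c else tri a b c
sort₂₃ (tri a b c) = if c <ᵇ b then tri a c b else tri a b c
sort t = sort₁₂ (sort₂₃ (sort₁₂ t))

sort₁₂-∼ : ∀ t → t ∼ sort₁₂ t
sort₁₂-∼ (tri a b c) with b <ᵇ a
... | true  = flip₁₂
... | false = ∼-refl

sort₂₃-∼ : ∀ t → t ∼ sort₂₃ t
sort₂₃-∼ (tri a b c) with c <ᵇ b
... | true  = flip₂₃
... | false = ∼-refl

sort-∼ : ∀ t → t ∼ sort t
sort-∼ t = ∼-trans (sort₁₂-∼ t) (∼-trans (sort₂₃-∼ (sort₁₂ t)) (sort₁₂-∼ (sort₂₃ (sort₁₂ t))))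

-- Transpositions of vertices

transpose : ℕ × ℕ → ℕ → ℕ
transpose (i , j) k = if k ≡ᵇ i then j else if k ≡ᵇ j then i else k

transpose-involutive : ∀ s k → transpose s (transpose s k) ≡ k
transpose-involutive (i , j) k with k ≡ᵇ i in k≡ᵇi
... | true  with j ≡ᵇ i in j≡ᵇi
...   | true  = trans (≡ᵇ⇒≡ j i (subst T (sym j≡ᵇi) _)) (sym (≡ᵇ⇒≡ k i (subst T (sym k≡ᵇi) _)))
...   | false with j ≡ᵇ j in j≡ᵇj
...     | true  = sym (≡ᵇ⇒≡ k i (subst T (sym k≡ᵇi) _))
...     | false = contradiction (trans (sym j≡ᵇj) (dec-true (j ≟ j) refl)) λ ()
transpose-involutive (i , j) k | false with k ≡ᵇ j in k≡ᵇj
...   | true  with i ≡ᵇ i in i≡ᵇi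
...     | true  = sym (≡ᵇ⇒≡ k j (subst T (sym k≡ᵇj) _))
...     | false = contradiction (trans (sym i≡ᵇi) (dec-true (i ≟ i) refl)) λ ()
transpose-involutive (i , j) k | false | false rewrite k≡ᵇi | k≡ᵇj = refl

mapᵗ-transpose-involutive : ∀ s t → mapᵗ (transpose s) (mapᵗ (transpose s) t) ≡ t
mapᵗ-transpose-involutive s (tri a b c)
  rewrite transpose-involutive s a | transpose-involutive s b | transpose-involutive s c = refl

-- Path-free 3-graphs

Meet Disjoint : Tri → Tri → Set
Meet e f     = ∃[ x ] x ∈ᵗ e × x ∈ᵗ f × (∀ {y} → y ∈ᵗ e → y ∈ᵗ f → y ≡ x)
Disjoint e f = ∀ {y} → y ∈ᵗ e → ¬ y ∈ᵗ f

-- Loose paths are described by incidences alone: consecutive edges share exactly one vertex and the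
-- ends are disjoint. Decidability in `edge?` lets the soundness proof ask whether an orbit contains
-- an edge.
record PathFree (H : Tri → Set) : Set where
  field
    resp-∼   : ∀ {t u} → t ∼ u → H t → H u
    edge?    : ∀ t → Dec (H t)
    pathFree : ∀ {e f g} → H e → H f → H g → Meet e f → Meet f g → ¬ Disjoint e g

_⊑_ : (Tri → Set) → List Tri → Set
H ⊑ L = ∀ {t} → H t → ∃[ u ] u ∈ L × t ∼ u

module _ (s : ℕ × ℕ) where

  private σ = transpose s

  ∈ᵗ-transpose : ∀ {x} t → x ∈ᵗ mapᵗ σ t → σ x ∈ᵗ t
  ∈ᵗ-transpose t x∈ = subst (_ ∈ᵗ_) (mapᵗ-transpose-involutive s t) (∈ᵗ-map⁺ σ (mapᵗ σ t) x∈)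

  Meet-transpose : ∀ e f → Meet e f → Meet (mapᵗ σ e) (mapᵗ σ f)
  Meet-transpose e f (x , x∈e , x∈f , only) =
    σ x , ∈ᵗ-map⁺ σ e x∈e , ∈ᵗ-map⁺ σ f x∈f ,
    λ y∈e y∈f → trans (sym (transpose-involutive s _))
                      (cong σ (only (∈ᵗ-transpose e y∈e) (∈ᵗ-transpose f y∈f)))

  -- The transposition is its own inverse, so this preimage of `H` is also its image, and a path in
  -- it would be carried to a path in `H`.
  PathFree-transpose : ∀ {H} → PathFree H → PathFree (H ∘ mapᵗ σ)
  PathFree-transpose pf = record
    { resp-∼   = λ t∼u → resp-∼ (∼-map σ t∼u)
    ; edge?    = λ t → edge? (mapᵗ σ t)
    ; pathFree = λ {e f g} He Hf Hg ef fg eg →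
        pathFree He Hf Hg (Meet-transpose e f ef) (Meet-transpose f g fg)
          (λ y∈e y∈g → eg (∈ᵗ-transpose e y∈e) (∈ᵗ-transpose g y∈g))
    }
    where open PathFree pf

-- Intersection sizes and pruning

shared : Tri → Tri → ℕ
shared (tri a b c) t = ind (a ∈ᵗ? t) + (ind (b ∈ᵗ? t) + ind (c ∈ᵗ? t))
  where
  ind : {A : Set} → Dec A → ℕ
  ind d = if does d then 1 else 0

shared≡0⇒Disjoint : ∀ e f → shared e f ≡ 0 → Disjoint e f
shared≡0⇒Disjoint (tri a b c) f eq with a ∈ᵗ? f | b ∈ᵗ? f | c ∈ᵗ? f
... | no a∉f | no b∉f | no c∉f = λ where
  (inj₁ refl) → a∉f
  (inj₂ (inj₁ refl)) → b∉f
  (inj₂ (inj₂ refl)) → c∉f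

shared≡1⇒Meet : ∀ e f → shared e f ≡ 1 → Meet e f
shared≡1⇒Meet (tri a b c) f eq with a ∈ᵗ? f | b ∈ᵗ? f | c ∈ᵗ? f
... | yes a∈f | no b∉f | no c∉f = a , inj₁ refl , a∈f , λ where
  (inj₁ refl) _ → refl
  (inj₂ (inj₁ refl)) y∈f → contradiction y∈f b∉f
  (inj₂ (inj₂ refl)) y∈f → contradiction y∈f c∉f
... | no a∉f | yes b∈f | no c∉f = b , inj₂ (inj₁ refl) , b∈f , λ where
  (inj₁ refl) y∈f → contradiction y∈f a∉f
  (inj₂ (inj₁ refl)) _ → refl
  (inj₂ (inj₂ refl)) y∈f → contradiction y∈f c∉f
... | no a∉f | no b∉f | yes c∈f = c , inj₂ (inj₂ refl) , c∈f , λ where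
  (inj₁ refl) y∈f → contradiction y∈f a∉f
  (inj₂ (inj₁ refl)) y∈f → contradiction y∈f b∉f
  (inj₂ (inj₂ refl)) _ → refl

Meet-sym : ∀ {e f} → Meet e f → Meet f e
Meet-sym (x , x∈e , x∈f , only) = x , x∈f , x∈e , λ y∈f y∈e → only y∈e y∈f

-- The first argument is shared e f.  The triples removed from the list are those which form a
-- path with e and f: with three edges, one pair is disjoint and the other two meet in a point.
prune : ℕ → Tri → Tri → List Tri → List Tri
prune 0 e f = filter (λ g → ¬? (shared g e ≟ 1 ×-dec shared g f ≟ 1))
prune 1 e f = filter (λ g → ¬? ((shared g e ≟ 0 ×-dec shared g f ≟ 1) ⊎-dec
                                (shared g e ≟ 1 ×-dec shared g f ≟ 0)))
prune _ e f = id

-- Only pairs involving the new edge `f` are treated: a pair of older edges was pruned when the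
-- later of the two was added.
pruneAll : Tri → List Tri → List Tri → List Tri
pruneAll f []       cand = cand
pruneAll f (e ∷ es) cand = pruneAll f es (prune (shared e f) e f cand)

-- Symmetries of a search state and orbits

image : ℕ × ℕ → Tri → Tri
image s t = sort (mapᵗ (transpose s) t)

-- In a state of the search, ins lists known edges, and cand contains all possible ones.
valid : ℕ → List Tri → List Tri → ℕ × ℕ → Bool
valid n ins cand s@(i , j) =
  ((i <ᵇ n) ∧ (j <ᵇ n)) ∧
  all (λ t → image s t ∈ᵇ ins) ins ∧
  all (λ t → (image s t ≡ᵗ t) ∨ (image s t ∈ᵇ cand)) cand

-- A transposition that fixes all vertices of the branching triple cannot move it, so one of the two
-- vertices is taken from the triple.
symmetries : ℕ → List Tri → List Tri → Tri → List (ℕ × ℕ)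
symmetries n ins cand (tri a b c) =
  filter (λ s → T? (valid n ins cand s)) (cartesianProduct (a ∷ b ∷ c ∷ []) (upTo n))

insert : Tri → List Tri → List Tri
insert t ts = if t ∈ᵇ ts then ts else t ∷ ts

images : ℕ × ℕ → List Tri → List Tri → List Tri
images s []       acc = acc
images s (t ∷ ts) acc = images s ts (insert (image s t) acc)

saturate : List (ℕ × ℕ) → List Tri → List Tri
saturate []       acc = acc
saturate (s ∷ ss) acc = saturate ss (images s acc acc)

-- Two rounds need not exhaust the orbit. Soundness asks only that each listed triple be reachable
-- from `t`; one that is missed stays a candidate.
orbit : List (ℕ × ℕ) → Tri → List Tri
orbit ss t = saturate ss (saturate ss (t ∷ []))

omit : List Tri → List Tri → List Tri
omit ts = filter (λ u → ¬? (T? (u ∈ᵇ ts)))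

-- The search and its stopping tests

hasCentre : List Tri → Bool
hasCentre []               = true
hasCentre (tri a b c ∷ ts) = does (any? (λ x → all? (x ∈ᵗ?_) ts) (a ∷ b ∷ c ∷ []))

commonVertices : List Tri → List ℕ
commonVertices (tri a b c ∷ t ∷ ts) =
  filter (λ x → all? (x ∈ᵗ?_) (t ∷ ts)) (a ∷ b ∷ c ∷ [])
commonVertices _ = []

-- Every choice of the branching triple is sound; this one keeps the search trees small.  It aims
-- at an edge which shows that the 3-graph is not a star, and avoids pairs of common vertices.
cost : List Tri → Tri → ℕ
cost ins t = penalty (commonVertices ins) + length (filter (λ e → shared e t ≟ 2) ins)
  where
  penalty : List ℕ → ℕ
  penalty (x ∷ []) = if does (x ∈ᵗ? t) then 20 else 0
  penalty _        = 0

cheapest : (Tri → ℕ) → Tri → ℕ → List Tri → Tri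
cheapest f t k []       = t
cheapest f t k (u ∷ us) with f u
... | m = if m <ᵇ k then cheapest f u m us else cheapest f t k us

-- The cost 100 of a known edge exceeds the initial bound 99, so known edges are passed over. The
-- default `tri 0 1 2` stands only if no candidate costs less than 99.
choose : List Tri → List Tri → Tri
choose ins cand = cheapest (λ t → if t ∈ᵇ ins then 100 else cost ins t) (tri 0 1 2) 99 cand

_⊆ᵗ_ : Tri → List ℕ → Set
tri a b c ⊆ᵗ X = a ∈ X × b ∈ X × c ∈ X

_⊆ᵗ?_ : ∀ t X → Dec (t ⊆ᵗ X)
tri a b c ⊆ᵗ? X = a ∈? X ×-dec b ∈? X ×-dec c ∈? X

record Halves (left right : List ℕ) (L : List Tri) : Set where
  constructor halves
  field
    left-size  : length left ≡ 6
    right-size : length right ≡ 6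
    disjoint   : All (λ x → ¬ x ∈ right) left
    covers     : All (λ t → t ⊆ᵗ left ⊎ t ⊆ᵗ right) L

halves? : ∀ left right L → Dec (Halves left right L)
halves? left right L =
  map′ (λ (a , b , c , d) → halves a b c d) (λ (halves a b c d) → a , b , c , d)
    (length left ≟ 6 ×-dec length right ≟ 6 ×-dec all? (λ x → ¬? (x ∈? right)) left
      ×-dec all? (λ t → t ⊆ᵗ? left ⊎-dec t ⊆ᵗ? right) L)

absorb : List Tri → List ℕ → List ℕ
absorb []               X = X
absorb (tri a b c ∷ ts) X = absorb ts
  (if does (a ∈? X ⊎-dec b ∈? X ⊎-dec c ∈? X)
   then filter (λ x → ¬? (x ∈? X)) (a ∷ b ∷ c ∷ []) ++ X else X)

-- Three passes are a heuristic closure; `halves?` checks what comes out of it.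
component : List Tri → List ℕ
component []                    = []
component L@(tri a b c ∷ _) = absorb L (absorb L (absorb L (a ∷ [])))

-- twins admits the subgraphs of two disjoint K_6 as a further outcome.
module Search (n B : ℕ) (twins : Bool) where

  remainder : List Tri → List ℕ
  remainder L = filter (λ x → ¬? (x ∈? component L)) (upTo n)

  -- Two disjoint K_6 have 2 · C(6,3) = 40 edges; the comparison of lengths rejects longer lists
  -- before the expensive test.
  halved : List Tri → Bool
  halved L = twins ∧ (length L ≤ᵇ 40) ∧
    does (halves? (component L) (remainder L) L)

  -- The first argument is fuel. Running out of it gives `false`, so the value `true` certifies a
  -- completed search.
  search : ℕ → List Tri → List Tri → Bool
  branch : ℕ → List Tri → List Tri → Tri → Bool
  search zero    ins cand = false
  search (suc k) ins cand =
    (length cand ≤ᵇ B) ∨ hasCentre cand ∨ halved cand ∨ branch k ins cand (choose ins cand)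
  branch k ins cand t =
    search k (t ∷ ins) (pruneAll t ins cand) ∧
    -- Here no listed triple of the orbit is an edge. If one is, a relabelling makes `t` itself an
    -- edge, which is the other branch.
    search k ins (omit (orbit (symmetries n ins cand t) t) cand)

-- Lists of triples and reflection of the Boolean tests

pairs : List ℕ → List (ℕ × ℕ)
pairs []       = []
pairs (x ∷ xs) = map (x ,_) xs ++ pairs xs

triples : List ℕ → List Tri
triples []       = []
triples (x ∷ xs) = map (λ (y , z) → tri x y z) (pairs xs) ++ triples xs

∈⇒⊆ᵗ : ∀ {X} t → (∀ {x} → x ∈ᵗ t → x ∈ X) → t ⊆ᵗ X
∈⇒⊆ᵗ (tri a b c) f = f (inj₁ refl) , f (inj₂ (inj₁ refl)) , f (inj₂ (inj₂ refl))

∈⇒∈ᵗ : ∀ {x a b c} → x ∈ a ∷ b ∷ c ∷ [] → x ∈ᵗ tri a b c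
∈⇒∈ᵗ (here x≡a)                 = inj₁ x≡a
∈⇒∈ᵗ (there (here x≡b))         = inj₂ (inj₁ x≡b)
∈⇒∈ᵗ (there (there (here x≡c))) = inj₂ (inj₂ x≡c)

⊆ᵗ⇒∈ : ∀ {X x} t → t ⊆ᵗ X → x ∈ᵗ t → x ∈ X
⊆ᵗ⇒∈ (tri a b c) (a∈X , b∈X , c∈X) = λ where
  (inj₁ refl) → a∈X
  (inj₂ (inj₁ refl)) → b∈X
  (inj₂ (inj₂ refl)) → c∈X

≡ᵗ⇒≡ : ∀ t u → T (t ≡ᵗ u) → t ≡ u
≡ᵗ⇒≡ (tri a b c) (tri a′ b′ c′) eq
  with a≡ , rest ← Equivalence.to T-∧ eq
  with b≡ , c≡ ← Equivalence.to (T-∧ {b ≡ᵇ b′}) rest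
  rewrite ≡ᵇ⇒≡ a a′ a≡ | ≡ᵇ⇒≡ b b′ b≡ | ≡ᵇ⇒≡ c c′ c≡ = refl

∈ᵇ⇒∈ : ∀ t us → T (t ∈ᵇ us) → t ∈ us
∈ᵇ⇒∈ t (u ∷ us) t∈us with Equivalence.to (T-∨ {t ≡ᵗ u}) t∈us
... | inj₁ t≡u   = here (≡ᵗ⇒≡ t u t≡u)
... | inj₂ t∈us′ = there (∈ᵇ⇒∈ t us t∈us′)

-- Soundness of the search

record Split (n : ℕ) (H : Tri → Set) : Set where
  field
    left right   : List ℕ
    left-length  : length left ≡ 6
    right-length : length right ≡ 6
    disjoint     : ∀ {x} → x ∈ left → ¬ x ∈ right
    total        : ∀ {x} → x < n → x ∈ left ⊎ x ∈ right
    one-sided    : ∀ {t} → H t → t ⊆ᵗ left ⊎ t ⊆ᵗ right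

data Outcome (n B : ℕ) (twins : Bool) (H : Tri → Set) : Set where
  star  : ∀ x → (∀ {t} → H t → x ∈ᵗ t) → Outcome n B twins H
  small : ∀ L → length L ≤ B → H ⊑ L → Outcome n B twins H
  split : T twins → Split n H → Outcome n B twins H

InRange : ℕ → ℕ × ℕ → Set
InRange n (i , j) = i < n × j < n

transpose-< : ∀ {n x} s → InRange n s → x < n → transpose s x < n
transpose-< {x = x} (i , j) (i<n , j<n) x<n with x ≡ᵇ i
... | true = j<n
... | false with x ≡ᵇ j
...   | true  = i<n
...   | false = x<n

module _ (s : ℕ × ℕ) {H : Tri → Set} where

  private
    σ = transpose s

    back : ∀ {t} → H t → H (mapᵗ σ (mapᵗ σ t))
    back {t} = subst H (sym (mapᵗ-transpose-involutive s t))

  ∈-map-transpose : ∀ {x X} → x ∈ map σ X → σ x ∈ X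
  ∈-map-transpose x∈ with y , y∈X , refl ← ∈-map⁻ σ x∈ =
    subst (_∈ _) (sym (transpose-involutive s y)) y∈X

  ⊆ᵗ-transpose : ∀ {X} t → mapᵗ σ t ⊆ᵗ X → t ⊆ᵗ map σ X
  ⊆ᵗ-transpose t σt⊆X = ∈⇒⊆ᵗ t λ x∈t →
    subst (_∈ _) (transpose-involutive s _) (∈-map⁺ σ (⊆ᵗ⇒∈ (mapᵗ σ t) σt⊆X (∈ᵗ-map⁺ σ t x∈t)))

  -- Allows the search to relabel: a result about the relabelled 3-graph is transported back. The
  -- range condition keeps the vertices below `n` among themselves, as `total` requires.
  Outcome-transpose : ∀ {n B twins} → InRange n s → Outcome n B twins (H ∘ mapᵗ σ) → Outcome n B twins H
  Outcome-transpose rng (star x x∈) = star (σ x) λ {t} Ht → ∈ᵗ-transpose s t (x∈ (back Ht))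
  Outcome-transpose rng (small L ∣L∣≤B H⊑L) =
    small (map (mapᵗ σ) L) (subst (_≤ _) (sym (length-map (mapᵗ σ) L)) ∣L∣≤B) λ {t} Ht →
      let u , u∈L , σt∼u = H⊑L (back Ht) in
      mapᵗ σ u , ∈-map⁺ (mapᵗ σ) u∈L ,
      subst (_∼ mapᵗ σ u) (mapᵗ-transpose-involutive s t) (∼-map σ σt∼u)
  Outcome-transpose rng (split twins sp) = split twins record
    { left         = map σ left
    ; right        = map σ right
    ; left-length  = trans (length-map σ left) left-length
    ; right-length = trans (length-map σ right) right-length
    ; disjoint     = λ x∈l x∈r → disjoint (∈-map-transpose x∈l) (∈-map-transpose x∈r)
    ; total        = λ x<n → Sum.map to-map to-map (total (transpose-< s rng x<n))
    ; one-sided    = λ {t} Ht → Sum.map (⊆ᵗ-transpose t) (⊆ᵗ-transpose t) (one-sided (back Ht))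
    }
    where
    open Split sp

    to-map : ∀ {x X} → σ x ∈ X → x ∈ map σ X
    to-map σx∈X = subst (_∈ _) (transpose-involutive s _) (∈-map⁺ σ σx∈X)

does⇒ : ∀ {A : Set} (a? : Dec A) → T (does a?) → A
does⇒ (yes a) _ = a

module _ {H : Tri → Set} (pf : PathFree H) where
  open PathFree pf

  -- If `e` and `f` are disjoint, a removed triple would be the middle edge of a path; if they meet
  -- once, it would be an end edge attached to `f` or to `e`.
  prune-⊑ : ∀ {e f L} → H e → H f → H ⊑ L → H ⊑ prune (shared e f) e f L
  prune-⊑ {e} {f} He Hf H⊑L {t} Ht with u , u∈L , t∼u ← H⊑L Ht with shared e f in eq
  ... | 0 = u , ∈-filter⁺ _ u∈L disjoint , t∼u
    where
    disjoint : ¬ (shared u e ≡ 1 × shared u f ≡ 1)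
    disjoint (ue , uf) = pathFree He (resp-∼ t∼u Ht) Hf
      (Meet-sym (shared≡1⇒Meet u e ue)) (shared≡1⇒Meet u f uf) (shared≡0⇒Disjoint e f eq)
  ... | 1 = u , ∈-filter⁺ _ u∈L end , t∼u
    where
    end : ¬ (shared u e ≡ 0 × shared u f ≡ 1 ⊎ shared u e ≡ 1 × shared u f ≡ 0)
    end (inj₁ (ue , uf)) = pathFree (resp-∼ t∼u Ht) Hf He
      (shared≡1⇒Meet u f uf) (Meet-sym (shared≡1⇒Meet e f eq)) (shared≡0⇒Disjoint u e ue)
    end (inj₂ (ue , uf)) = pathFree (resp-∼ t∼u Ht) He Hf
      (shared≡1⇒Meet u e ue) (shared≡1⇒Meet e f eq) (shared≡0⇒Disjoint u f uf)
  ... | suc (suc _) = u , u∈L , t∼u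

  pruneAll-⊑ : ∀ {f es L} → H f → All H es → H ⊑ L → H ⊑ pruneAll f es L
  pruneAll-⊑ Hf []         H⊑L = H⊑L
  pruneAll-⊑ Hf (He ∷ Hes) H⊑L = pruneAll-⊑ Hf Hes (prune-⊑ He Hf H⊑L)

  omit-⊑ : ∀ {ts L} → ¬ Any H ts → H ⊑ L → H ⊑ omit ts L
  omit-⊑ {ts} none H⊑L Ht with u , u∈L , t∼u ← H⊑L Ht =
    u , ∈-filter⁺ _ u∈L (λ u∈ts → none (lose (∈ᵇ⇒∈ u ts u∈ts) (resp-∼ t∼u Ht))) , t∼u

  centre : ∀ {L} → T (hasCentre L) → H ⊑ L → ∃[ x ] (∀ {t} → H t → x ∈ᵗ t)
  -- Without candidates there are no edges, and any vertex is a centre.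
  centre {[]} _ H⊑L = 0 , λ Ht → contradiction (proj₁ (proj₂ (H⊑L Ht))) λ ()
  centre {tri a b c ∷ ts} ok H⊑L
    with x , x∈ , x∈ts ← find (does⇒ (any? (λ x → all? (x ∈ᵗ?_) ts) (a ∷ b ∷ c ∷ [])) ok) =
    x , through
    where
    through : ∀ {t} → H t → x ∈ᵗ t
    through Ht with H⊑L Ht
    ... | _ , here refl  , t∼u = ∈ᵗ-resp-∼ (∼-sym t∼u) (∈⇒∈ᵗ x∈)
    ... | _ , there u∈ts , t∼u = ∈ᵗ-resp-∼ (∼-sym t∼u) (All.lookup x∈ts u∈ts)

module _ (n B : ℕ) (twins : Bool) where
  open Search n B twins

  halved-sound : ∀ {H L} → T (halved L) → H ⊑ L → Outcome n B twins H
  halved-sound {H} {L} ok H⊑L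
    with twins✓ , rest ← Equivalence.to (T-∧ {twins}) ok
    with _ , halves✓ ← Equivalence.to (T-∧ {length L ≤ᵇ 40}) rest =
    split twins✓ record
      { left-length  = left-size
      ; right-length = right-size
      ; disjoint     = All.lookup disjoint
      ; total        = cover
      ; one-sided    = λ {t} Ht → let u , u∈L , t∼u = H⊑L Ht in
          Sum.map (⊆-resp t∼u) (⊆-resp t∼u) (All.lookup covers u∈L)
      }
    where
    cover : ∀ {x} → x < n → x ∈ component L ⊎ x ∈ remainder L
    cover {x} x<n with x ∈? component L
    ... | yes x∈ = inj₁ x∈
    ... | no  x∉ = inj₂ (∈-filter⁺ _ (∈-upTo⁺ x<n) x∉)

    open Halves (does⇒ (halves? (component L) (remainder L) L) halves✓)

    ⊆-resp : ∀ {t u X} → t ∼ u → u ⊆ᵗ X → t ⊆ᵗ X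
    ⊆-resp {t} {u} t∼u u⊆X = ∈⇒⊆ᵗ t λ x∈t → ⊆ᵗ⇒∈ u u⊆X (∈ᵗ-resp-∼ t∼u x∈t)

  module _ (ins cand : List Tri) where

    -- Records how a triple arises from `t` by symmetries of the state, so that they can be undone
    -- one at a time.
    data Reachable (t : Tri) : Tri → Set where
      start : Reachable t t
      step  : ∀ {u s} → T (valid n ins cand s) → Reachable t u →
              Reachable t (image s u)

    insert⁺ : ∀ {P : Tri → Set} {t us} → P t → All P us → All P (insert t us)
    insert⁺ {t = t} {us} Pt Pus with t ∈ᵇ us
    ... | true  = Pus
    ... | false = Pt ∷ Pus

    images-reachable : ∀ {t s us acc} → T (valid n ins cand s) →
      All (Reachable t) us → All (Reachable t) acc → All (Reachable t) (images s us acc)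
    images-reachable v []       racc = racc
    images-reachable v (r ∷ rs) racc = images-reachable v rs (insert⁺ (step v r) racc)

    saturate-reachable : ∀ {t ss acc} → All (T ∘ valid n ins cand) ss →
      All (Reachable t) acc → All (Reachable t) (saturate ss acc)
    saturate-reachable []       racc = racc
    saturate-reachable (v ∷ vs) racc = saturate-reachable vs (images-reachable v racc racc)

    orbit-reachable : ∀ t → All (Reachable t) (orbit (symmetries n ins cand t) t)
    orbit-reachable t@(tri a b c) = saturate-reachable vs (saturate-reachable vs (start ∷ []))
      where
      vs : All (T ∘ valid n ins cand) (symmetries n ins cand t)
      vs = all-filter _ (cartesianProduct (a ∷ b ∷ c ∷ []) (upTo n))

    valid⁻ : ∀ {s} → T (valid n ins cand s) →
             InRange n s × All (λ t → image s t ∈ ins) ins × All (λ t → image s t ∈ cand) cand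
    valid⁻ {s@(i , j)} v
      with rng , rest ← Equivalence.to (T-∧ {(i <ᵇ n) ∧ (j <ᵇ n)}) v
      with i< , j< ← Equivalence.to (T-∧ {i <ᵇ n}) rng
      with ins✓ , cand✓ ← Equivalence.to (T-∧ {all (λ t → image s t ∈ᵇ ins) ins}) rest =
      (<ᵇ⇒< i n i< , <ᵇ⇒< j n j<) ,
      All.map (λ {t} → ∈ᵇ⇒∈ (image s t) ins) (all⁺ _ ins ins✓) ,
      All.zipWith mem (all⁺ _ cand cand✓ , All.tabulate id)
      where
      mem : ∀ {t} → T ((image s t ≡ᵗ t) ∨ (image s t ∈ᵇ cand)) × t ∈ cand → image s t ∈ cand
      mem {t} (ok , t∈) with Equivalence.to (T-∨ {image s t ≡ᵗ t}) ok
      ... | inj₁ eq  = subst (_∈ cand) (sym (≡ᵗ⇒≡ (image s t) t eq)) t∈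
      ... | inj₂ im∈ = ∈ᵇ⇒∈ (image s t) cand im∈

    valid-ins : ∀ {H s} → PathFree H → T (valid n ins cand s) → All H ins →
                All (H ∘ mapᵗ (transpose s)) ins
    valid-ins pf v Hins =
      All.map (λ im∈ → PathFree.resp-∼ pf (∼-sym (sort-∼ _)) (All.lookup Hins im∈))
        (proj₁ (proj₂ (valid⁻ v)))

    -- If the image of `t` is an edge, it matches some candidate `u`; then `t` matches the image of
    -- `u`, again a candidate.
    valid-cand : ∀ {H s} → T (valid n ins cand s) → H ⊑ cand → (H ∘ mapᵗ (transpose s)) ⊑ cand
    valid-cand {s = s} v H⊑ {t} Ht with u , u∈ , σt∼u ← H⊑ Ht =
      image s u , All.lookup (proj₂ (proj₂ (valid⁻ v))) u∈ ,
      ∼-trans (subst (_∼ mapᵗ (transpose s) u) (mapᵗ-transpose-involutive s t)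
                     (∼-map (transpose s) σt∼u)) (sort-∼ _)

  -- Quantified over all `H`, because a symmetry preserves the state but changes the 3-graph.
  Sound : List Tri → List Tri → Set₁
  Sound ins cand = ∀ {H} → PathFree H → All H ins → H ⊑ cand → Outcome n B twins H

  search-sound : ∀ k ins cand → T (search k ins cand) → Sound ins cand
  branch-sound : ∀ k ins cand t → T (branch k ins cand t) → Sound ins cand

  search-sound (suc k) ins cand ok pf Hins H⊑ with Equivalence.to (T-∨ {length cand ≤ᵇ B}) ok
  ... | inj₁ few = small cand (≤ᵇ⇒≤ _ _ few) H⊑
  ... | inj₂ ok₁ with Equivalence.to (T-∨ {hasCentre cand}) ok₁
  ...   | inj₁ central = let x , x∈ = centre pf central H⊑ in star x x∈
  ...   | inj₂ ok₂ with Equivalence.to (T-∨ {halved cand}) ok₂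
  ...     | inj₁ half = halved-sound half H⊑
  ...     | inj₂ ok₃  = branch-sound k ins cand (choose ins cand) ok₃ pf Hins H⊑

  branch-sound k ins cand t ok {H} pf Hins H⊑
    with ok₁ , ok₂ ← Equivalence.to (T-∧ {search k (t ∷ ins) (pruneAll t ins cand)}) ok
    with any? (PathFree.edge? pf) (orbit (symmetries n ins cand t) t)
  ... | no none = search-sound k ins _ ok₂ pf Hins (omit-⊑ pf none H⊑)
  ... | yes hit with u , u∈ , Hu ← find hit =
    along (All.lookup (orbit-reachable ins cand t) u∈) pf Hins H⊑ Hu
    where
    -- Each step relabels `H` by the last transposition on the way from `t` to `u`; at the start,
    -- `t` is an edge of the relabelled 3-graph.
    along : ∀ {H u} → Reachable ins cand t u → PathFree H → All H ins → H ⊑ cand → H u →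
            Outcome n B twins H
    along start pf Hins H⊑ Ht =
      search-sound k (t ∷ ins) _ ok₁ pf (Ht ∷ Hins) (pruneAll-⊑ pf Ht Hins H⊑)
    along (step {u} {s} v r) pf Hins H⊑ Hσu =
      Outcome-transpose s (proj₁ (valid⁻ ins cand v))
        (along r (PathFree-transpose s pf) (valid-ins ins cand pf v Hins)
          (valid-cand ins cand v H⊑) (PathFree.resp-∼ pf (∼-sym (sort-∼ _)) Hσu))

-- Counting triples

∈-pairs : ∀ {x y xs} → x ≢ y → x ∈ xs → y ∈ xs → (x , y) ∈ pairs xs ⊎ (y , x) ∈ pairs xs
∈-pairs x≢y (here refl) (here refl) = contradiction refl x≢y
∈-pairs x≢y (here refl) (there y∈)  = inj₁ (∈-++⁺ˡ (∈-map⁺ _ y∈))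
∈-pairs x≢y (there x∈)  (here refl) = inj₂ (∈-++⁺ˡ (∈-map⁺ _ x∈))
∈-pairs x≢y (there x∈)  (there y∈)  = Sum.map (∈-++⁺ʳ _) (∈-++⁺ʳ _) (∈-pairs x≢y x∈ y∈)

-- The entry that occurs earliest in `xs` is swapped to the front, and the other two are found among
-- the later pairs.
∈-triples : ∀ {a b c xs} → a ≢ b → a ≢ c → b ≢ c → a ∈ xs → b ∈ xs → c ∈ xs →
            ∃[ u ] u ∈ triples xs × tri a b c ∼ u
∈-triples {xs = x ∷ xs} a≢b a≢c b≢c = go
  where
  first : ∀ {b c} → b ≢ c → b ∈ xs → c ∈ xs → ∃[ u ] u ∈ triples (x ∷ xs) × tri x b c ∼ u
  first b≢c b∈ c∈ with ∈-pairs b≢c b∈ c∈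
  ... | inj₁ bc∈ = _ , ∈-++⁺ˡ (∈-map⁺ _ bc∈) , ∼-refl
  ... | inj₂ cb∈ = _ , ∈-++⁺ˡ (∈-map⁺ _ cb∈) , flip₂₃

  via : ∀ {t t′} → t ∼ t′ → ∃[ u ] u ∈ triples (x ∷ xs) × t′ ∼ u →
        ∃[ u ] u ∈ triples (x ∷ xs) × t ∼ u
  via t∼t′ (u , u∈ , t′∼u) = u , u∈ , ∼-trans t∼t′ t′∼u

  go : _ ∈ x ∷ xs → _ ∈ x ∷ xs → _ ∈ x ∷ xs → _
  go (here refl) (here refl) _           = contradiction refl a≢b
  go (here refl) (there b∈)  (here refl) = contradiction refl a≢c
  go (here refl) (there b∈)  (there c∈)  = first b≢c b∈ c∈
  go (there a∈)  (here refl) (here refl) = contradiction refl b≢c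
  go (there a∈)  (here refl) (there c∈)  = via flip₁₂ (first a≢c a∈ c∈)
  go (there a∈)  (there b∈)  (here refl) = via (∼-trans flip₂₃ flip₁₂) (first a≢b a∈ b∈)
  go (there a∈)  (there b∈)  (there c∈)  =
    let u , u∈ , ∼u = ∈-triples a≢b a≢c b≢c a∈ b∈ c∈ in u , ∈-++⁺ʳ _ u∈ , ∼u

∈-pairs⁻ : ∀ {x y xs} → Unique xs → (x , y) ∈ pairs xs → x ∈ xs × y ∈ xs × x ≢ y
∈-pairs⁻ {xs = z ∷ zs} (z∉ ∷ uniq) p with ∈-++⁻ (map (z ,_) zs) p
... | inj₁ q with _ , y∈ , refl ← ∈-map⁻ (z ,_) q = here refl , there y∈ , All.lookup z∉ y∈
... | inj₂ q with x∈ , y∈ , x≢y ← ∈-pairs⁻ uniq q = there x∈ , there y∈ , x≢y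

∈-triples⁻ : ∀ {a b c xs} → Unique xs → tri a b c ∈ triples xs →
             (a ∈ xs × b ∈ xs × c ∈ xs) × a ≢ b × a ≢ c × b ≢ c
∈-triples⁻ {xs = z ∷ zs} (z∉ ∷ uniq) p with ∈-++⁻ (map _ (pairs zs)) p
... | inj₁ q with _ , bc∈ , refl ← ∈-map⁻ _ q with b∈ , c∈ , b≢c ← ∈-pairs⁻ uniq bc∈ =
  (here refl , there b∈ , there c∈) , All.lookup z∉ b∈ , All.lookup z∉ c∈ , b≢c
... | inj₂ q with (a∈ , b∈ , c∈) , distinct ← ∈-triples⁻ uniq q =
  (there a∈ , there b∈ , there c∈) , distinct

-- Deleting the head `x` from `ys` shortens `ys` and keeps the tail inside it, since `x` does not
-- recur there.
unique-⊆⇒length≤ : ∀ {xs ys : List ℕ} → Unique xs → (∀ {x} → x ∈ xs → x ∈ ys) → length xs ≤ length ys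
unique-⊆⇒length≤ {[]}     []            xs⊆ys = z≤n
unique-⊆⇒length≤ {x ∷ xs} (x∉ ∷ uniq) xs⊆ys =
  ≤-trans (s≤s (unique-⊆⇒length≤ uniq λ y∈ →
            ∈-filter⁺ (λ y → ¬? (x ≟ y)) (xs⊆ys (there y∈)) (All.lookup x∉ y∈)))
    (filter-notAll (λ y → ¬? (x ≟ y)) _ (Any.map (λ x≡y x≢y → x≢y x≡y) (xs⊆ys (here refl))))

-- An invariant under reordering which separates the triples of a set.
key : Tri → ℕ
key (tri a b c) = 2 ^ a + 2 ^ b + 2 ^ c

key-resp-∼ : ∀ {t u} → t ∼ u → key t ≡ key u
key-resp-∼ ∼-refl                     = refl
key-resp-∼ (∼-trans p q)              = trans (key-resp-∼ p) (key-resp-∼ q)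
key-resp-∼ (flip₁₂ {a} {b} {c})       = cong (_+ 2 ^ c) (+-comm (2 ^ a) (2 ^ b))
key-resp-∼ (flip₂₃ {a} {b} {c})       =
  trans (+-assoc (2 ^ a) (2 ^ b) (2 ^ c))
    (trans (cong (2 ^ a +_) (+-comm (2 ^ b) (2 ^ c))) (sym (+-assoc (2 ^ a) (2 ^ c) (2 ^ b))))

-- Passing to keys turns a match up to reordering into plain membership.
cover-length : ∀ {ts L} → Unique (map key ts) → (∀ {t} → t ∈ ts → ∃[ u ] u ∈ L × t ∼ u) →
               length ts ≤ length L
cover-length {ts} {L} uniq cover =
  subst₂ _≤_ (length-map key ts) (length-map key L) (unique-⊆⇒length≤ uniq keys)
  where
  keys : ∀ {k} → k ∈ map key ts → k ∈ map key L
  keys k∈ with t , t∈ , refl ← ∈-map⁻ key k∈ with u , u∈ , t∼u ← cover t∈ =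
    subst (_∈ map key L) (sym (key-resp-∼ t∼u)) (∈-map⁺ key u∈)

length-concatMap≤ : ∀ {A B : Set} (f : A → List B) {b} → (∀ i → length (f i) ≤ b) →
                    ∀ is → length (concatMap f is) ≤ length is * b
length-concatMap≤ f bound []       = z≤n
length-concatMap≤ f bound (i ∷ is) =
  ≤-trans (≤-reflexive (length-++ (f i))) (+-mono-≤ (bound i) (length-concatMap≤ f bound is))

length-concat-allFin≤ : ∀ {B : Set} {r b} (f : Fin r → List B) → (∀ i → length (f i) ≤ b) →
                        length (concatMap f (allFin r)) ≤ r * b
length-concat-allFin≤ {r = r} {b} f bound =
  ≤-trans (length-concatMap≤ f bound (allFin r))
    (≤-reflexive (cong (_* b) (length-tabulate {n = r} id)))

∈-concat-allFin : ∀ {B : Set} {r} (f : Fin r → List B) i {x} → x ∈ f i → x ∈ concatMap f (allFin r)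
∈-concat-allFin f i x∈ = ∈-concatMap⁺ f (lose (∈-allFin i) x∈)

splitFin : ∀ {r} {P Q : Fin r → Set} → (∀ i → P i ⊎ Q i) → ∃ P ⊎ (∀ i → Q i)
splitFin {zero}  _ = inj₂ λ ()
splitFin {suc r} f with f zero | splitFin (f ∘ suc)
... | inj₁ p | _            = inj₁ (zero , p)
... | inj₂ q | inj₁ (i , p) = inj₁ (suc i , p)
... | inj₂ q | inj₂ qs      = inj₂ λ { zero → q ; (suc i) → qs i }

without : ∀ {r} (i j : Fin (suc r)) → i ≡ j ⊎ ∃[ k ] punchIn i k ≡ j
without i j with i Fin.≟ j
... | yes i≡j = inj₁ i≡j
... | no  i≢j = inj₂ (punchOut i≢j , Fin.punchIn-punchOut i≢j)

-- Finding a star by counting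

Star : (Tri → Set) → Set
Star H = ∃[ x ] (∀ {t} → H t → x ∈ᵗ t)

Small : ℕ → (Tri → Set) → Set
Small B H = ∃[ L ] length L ≤ B × H ⊑ L

record PathFreeColouring (n r : ℕ) (H : Fin r → Tri → Set) : Set where
  field
    isPathFree : ∀ c → PathFree (H c)
    inRange    : ∀ c → H c ⊑ triples (upTo n)
    covers     : ∀ {t} → t ∈ triples (upTo n) → ∃[ c ] H c t

module _ {n r : ℕ} {H : Fin r → Tri → Set} (col : PathFreeColouring n r H) where
  open PathFreeColouring col

  outcome : ∀ {B twins k} → Search.search n B twins k [] (triples (upTo n)) ≡ true →
            ∀ c → Outcome n B twins (H c)
  outcome {B} {twins} {k} ok c =
    search-sound n B twins k [] _ (Equivalence.from T-≡ ok) (isPathFree c) [] (inRange c)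

  cover : ∀ {L} → Unique (map key (triples (upTo n))) → (∀ c → H c ⊑ L) →
          length (triples (upTo n)) ≤ length L
  cover uniq H⊑L = cover-length uniq λ t∈ → let c , Hct = covers t∈ in H⊑L c Hct

  cover-smalls : ∀ {B} → Unique (map key (triples (upTo n))) → (∀ c → Small B (H c)) →
                 length (triples (upTo n)) ≤ r * B
  cover-smalls uniq smalls =
    ≤-trans (cover uniq sub) (length-concat-allFin≤ lists (proj₁ ∘ proj₂ ∘ smalls))
    where
    lists : Fin r → List Tri
    lists = proj₁ ∘ smalls

    sub : ∀ c → H c ⊑ concatMap lists (allFin r)
    sub c Ht with u , u∈ , t∼u ← proj₂ (proj₂ (smalls c)) Ht = u , ∈-concat-allFin lists c u∈ , t∼u

  -- If every class were small, `r` lists of at most `B` triples each would cover all triples,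
  -- against the numerical hypothesis.
  star-by-counting : ∀ {B k} → Search.search n B false k [] (triples (upTo n)) ≡ true →
    Unique (map key (triples (upTo n))) → r * B < length (triples (upTo n)) → ∃[ c ] Star (H c)
  star-by-counting {B} {k} ok uniq few with splitFin starOrSmall
    where
    starOrSmall : ∀ c → Star (H c) ⊎ Small B (H c)
    starOrSmall c with outcome {B} {false} {k} ok c
    ... | star x x∈     = inj₁ (x , x∈)
    ... | small L L≤ ⊑L = inj₂ (L , L≤ , ⊑L)
    ... | split () _
  ... | inj₁ found  = found
  ... | inj₂ smalls = contradiction (cover-smalls uniq smalls) (<⇒≱ few)

-- Triples across two halves

Monochromatic : Tri → Set
Monochromatic (tri a b c) = a ≡ b × b ≡ c

monochromatic? : ∀ t → Dec (Monochromatic t)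
monochromatic? (tri a b c) = a ≟ b ×-dec b ≟ c

Monochromatic-resp-∼ : ∀ {t u} → t ∼ u → Monochromatic t → Monochromatic u
Monochromatic-resp-∼ ∼-refl        m           = m
Monochromatic-resp-∼ (∼-trans p q) m           = Monochromatic-resp-∼ q (Monochromatic-resp-∼ p m)
Monochromatic-resp-∼ flip₁₂        (a≡b , b≡c) = sym a≡b , trans a≡b b≡c
Monochromatic-resp-∼ flip₂₃        (a≡b , b≡c) = trans a≡b b≡c , sym b≡c

Proper : ℕ → Tri → Set
Proper n (tri a b c) = (a < n × b < n × c < n) × a ≢ b × a ≢ c × b ≢ c

Proper-resp-∼ : ∀ {n t u} → t ∼ u → Proper n t → Proper n u
Proper-resp-∼ ∼-refl        p = p
Proper-resp-∼ (∼-trans p q) r = Proper-resp-∼ q (Proper-resp-∼ p r)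
Proper-resp-∼ flip₁₂ ((a< , b< , c<) , a≢b , a≢c , b≢c) = (b< , a< , c<) , a≢b ∘ sym , b≢c , a≢c
Proper-resp-∼ flip₂₃ ((a< , b< , c<) , a≢b , a≢c , b≢c) = (a< , c< , b<) , a≢c , a≢b , b≢c ∘ sym

triples-proper : ∀ {n t} → t ∈ triples (upTo n) → Proper n t
triples-proper {n} {tri a b c} t∈ with (a∈ , b∈ , c∈) , distinct ← ∈-triples⁻ (upTo⁺ n) t∈ =
  (∈-upTo⁻ a∈ , ∈-upTo⁻ b∈ , ∈-upTo⁻ c∈) , distinct

within : ∀ {n X t} → Proper n t → t ⊆ᵗ X → ∃[ u ] u ∈ triples X × t ∼ u
within {t = tri a b c} (_ , a≢b , a≢c , b≢c) (a∈ , b∈ , c∈) = ∈-triples a≢b a≢c b≢c a∈ b∈ c∈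

-- The entries stand for labels of halves, so the triples kept are those that meet both halves.
crossing : List Tri → List Tri
crossing = filter (¬? ∘ monochromatic?)

crossing-along : (ℕ → ℕ) → List Tri → List Tri
crossing-along f = filter (λ t → ¬? (monochromatic? (mapᵗ f t)))

crossing-map : ∀ f ts → length (crossing-along f ts) ≡ length (crossing (map (mapᵗ f) ts))
crossing-map f []       = refl
crossing-map f (t ∷ ts) with does (monochromatic? (mapᵗ f t))
... | true  = crossing-map f ts
... | false = cong suc (crossing-map f ts)

bit : Bool → ℕ
bit b = if b then 1 else 0

-- Only the sides of the six vertices matter; all 64 assignments are tested by evaluation.
crossing≤18 : ∀ (s : Subset 6) → length (crossing (triples (map bit (Vec.toList s)))) ≤ 18
crossing≤18 s = ≮⇒≥ λ 18< → toWitnessFalse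
  {a? = anySubset? λ s → 18 <? length (crossing (triples (map bit (Vec.toList s))))} _ (s , 18<)

-- A six-set with k vertices in one half has C(k,3) + C(6-k,3) ≥ 2 triples within the halves.
crossing-along≤18 : ∀ (side : ℕ → Bool) xs → length xs ≡ 6 →
                    length (crossing-along (bit ∘ side) (triples xs)) ≤ 18
crossing-along≤18 side xs@(a ∷ b ∷ c ∷ d ∷ e ∷ f ∷ []) refl =
  ≤-trans (≤-reflexive (crossing-map (bit ∘ side) (triples xs)))
    (crossing≤18 (side a Vec.∷ side b Vec.∷ side c Vec.∷ side d Vec.∷ side e Vec.∷ side f Vec.∷ Vec.[]))

length-triples-six : ∀ (xs : List ℕ) → length xs ≡ 6 → length (triples xs) ≡ 20
length-triples-six (_ ∷ _ ∷ _ ∷ _ ∷ _ ∷ _ ∷ []) refl = refl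

-- Multiplicities and links

multiplicity : ℕ → List ℕ → ℕ
multiplicity x xs = length (filter (x ≟_) xs)

delete : ℕ → List ℕ → List ℕ
delete x = filter (λ y → ¬? (x ≟ y))

length-delete : ∀ x xs → length xs ≡ multiplicity x xs + length (delete x xs)
length-delete x []       = refl
length-delete x (y ∷ xs) with does (x ≟ y)
... | true  = cong suc (length-delete x xs)
... | false = trans (cong suc (length-delete x xs)) (sym (+-suc _ _))

multiplicity-delete : ∀ {x y} → x ≢ y → ∀ xs → multiplicity y (delete x xs) ≡ multiplicity y xs
multiplicity-delete {x} {y} x≢y []       = refl
multiplicity-delete {x} {y} x≢y (z ∷ xs) with x ≟ z
... | yes refl = trans (cong (multiplicity y) (filter-reject (λ w → ¬? (x ≟ w)) (λ x≢x → x≢x refl)))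
  (trans (multiplicity-delete x≢y xs) (cong length (sym (filter-reject (y ≟_) (x≢y ∘ sym)))))
... | no x≢z = trans (cong (multiplicity y) (filter-accept (λ w → ¬? (x ≟ w)) x≢z)) cons
  where
  cons : multiplicity y (z ∷ delete x xs) ≡ multiplicity y (z ∷ xs)
  cons with does (y ≟ z)
  ... | true  = cong suc (multiplicity-delete x≢y xs)
  ... | false = multiplicity-delete x≢y xs

-- Deleting the occurrences of one element leaves those of every other element untouched, so the
-- bounds add up.
multiplicities≤length : ∀ {xs} k ys → Unique xs → (∀ {x} → x ∈ xs → k ≤ multiplicity x ys) →
                        length xs * k ≤ length ys
multiplicities≤length {xs = []}     k ys _             _     = z≤n
multiplicities≤length {xs = x ∷ xs} k ys (x∉ ∷ uniq) often =
  ≤-trans (+-mono-≤ (often (here refl)) (multiplicities≤length k (delete x ys) uniq λ y∈ →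
            ≤-trans (often (there y∈)) (≤-reflexive (sym (multiplicity-delete (All.lookup x∉ y∈) ys)))))
    (≤-reflexive (sym (length-delete x ys)))

-- The neighbours of x in the complete graph on xs.
link : ℕ → List ℕ → List ℕ
link x xs = if does (x ∈? xs) then delete x xs else []

∈-link : ∀ {x y xs} → x ∈ xs → y ∈ xs → x ≢ y → y ∈ link x xs
∈-link {x} {xs = xs} x∈ y∈ x≢y with x ∈? xs
... | yes _ = ∈-filter⁺ _ y∈ x≢y
... | no x∉ = contradiction x∈ x∉

length-link : ∀ x xs {m} → length xs ≤ suc m → length (link x xs) ≤ m
length-link x xs ∣xs∣≤ with x ∈? xs
... | no  _  = z≤n
... | yes x∈ = ≤-pred (≤-trans (filter-notAll _ xs (Any.map (λ x≡y x≢y → x≢y x≡y) x∈)) ∣xs∣≤)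

length-link-multiplicity : ∀ x xs {m} → length xs ≤ suc m →
                           length (link x xs) ≤ m * multiplicity x xs
length-link-multiplicity x xs {m} ∣xs∣≤ with x ∈? xs | length-link x xs ∣xs∣≤
... | no  _  | _    = z≤n
... | yes x∈ | ∣l∣≤ = ≤-trans ∣l∣≤
  (≤-trans (≤-reflexive (sym (*-identityʳ m))) (*-monoʳ-≤ m (filter-some (x ≟_) x∈)))

-- A block containing `x` contributes at most `m` neighbours and at least one to the multiplicity;
-- the other blocks contribute no neighbours.
length-concat-link : ∀ {A : Set} {m} x (B : A → List ℕ) → (∀ i → length (B i) ≤ suc m) → ∀ is →
  length (concatMap (link x ∘ B) is) ≤ m * multiplicity x (concatMap B is)
length-concat-link x B bound [] = z≤n
length-concat-link {m = m} x B bound (i ∷ is) = begin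
  length (link x (B i) ++ concatMap (link x ∘ B) is)
    ≡⟨ length-++ (link x (B i)) ⟩
  length (link x (B i)) + length (concatMap (link x ∘ B) is)
    ≤⟨ +-mono-≤ (length-link-multiplicity x (B i) (bound i)) (length-concat-link x B bound is) ⟩
  m * multiplicity x (B i) + m * multiplicity x (concatMap B is)
    ≡⟨ *-distribˡ-+ m (multiplicity x (B i)) _ ⟨
  m * (multiplicity x (B i) + multiplicity x (concatMap B is))
    ≡⟨ cong (m *_) (length-++ (filter (x ≟_) (B i))) ⟨
  m * length (filter (x ≟_) (B i) ++ filter (x ≟_) (concatMap B is))
    ≡⟨ cong (λ ys → m * length ys) (filter-++ (x ≟_) (B i) (concatMap B is)) ⟨
  m * multiplicity x (B i ++ concatMap B is) ∎
  where open ≤-Reasoning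

-- The case of twelve vertices

module Twelve {H : Fin 6 → Tri → Set} (col : PathFreeColouring 12 6 H)
              (uniq : Unique (map key (triples (upTo 12)))) where
  open PathFreeColouring col

  proper : ∀ {i t} → H i t → Proper 12 t
  proper {i} Ht with u , u∈ , t∼u ← inRange i Ht = Proper-resp-∼ (∼-sym t∼u) (triples-proper u∈)

  distinct-covers : ∀ {a b c} → a ≢ b → a ≢ c → b ≢ c → a < 12 → b < 12 → c < 12 →
                    ∃[ i ] H i (tri a b c)
  distinct-covers a≢b a≢c b≢c a< b< c<
    with u , u∈ , t∼u ← ∈-triples a≢b a≢c b≢c (∈-upTo⁺ a<) (∈-upTo⁺ b<) (∈-upTo⁺ c<)
    with i , Hu ← covers u∈ = i , PathFree.resp-∼ (isPathFree i) (∼-sym t∼u) Hu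

  -- The fixed vertex is 0, and `B i` lists the other five vertices of its half in colour `i`.
  -- Eleven vertices occurring at least three times need 33 places, but `D` has at most 30.
  not-all-split : ¬ (∀ i → Split 12 (H i))
  not-all-split sp = contradiction
    (≤-trans (multiplicities≤length 3 D rest-unique often)
      (length-concat-allFin≤ B B≤5)) (<⇒≱ (toWitness {a? = 30 <? 33} _))
    where
    block : Fin 6 → List ℕ
    block i = if does (0 ∈? Split.left (sp i)) then Split.left (sp i) else Split.right (sp i)

    block-length : ∀ i → length (block i) ≡ 6
    block-length i with does (0 ∈? Split.left (sp i))
    ... | true  = Split.left-length (sp i)
    ... | false = Split.right-length (sp i)

    block-⊆ : ∀ {i t} → H i t → 0 ∈ᵗ t → t ⊆ᵗ block i
    block-⊆ {i} {t} Ht 0∈ with 0 ∈? Split.left (sp i) | Split.one-sided (sp i) Ht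
    ... | yes _  | inj₁ t⊆ = t⊆
    ... | yes 0∈l | inj₂ t⊆ = contradiction (⊆ᵗ⇒∈ t t⊆ 0∈) (Split.disjoint (sp i) 0∈l)
    ... | no 0∉l | inj₁ t⊆ = contradiction (⊆ᵗ⇒∈ t t⊆ 0∈) 0∉l
    ... | no _   | inj₂ t⊆ = t⊆

    B : Fin 6 → List ℕ
    B i = link 0 (block i)

    B≤5 : ∀ i → length (B i) ≤ 5
    B≤5 i = length-link 0 (block i) (≤-reflexive (block-length i))

    D : List ℕ
    D = concatMap B (allFin 6)

    rest : List ℕ
    rest = applyUpTo suc 11

    rest-unique : Unique rest
    rest-unique = applyUpTo⁺₁ suc 11 λ i<j _ eq → <⇒≢ i<j (suc-injective eq)

    often : ∀ {x} → x ∈ rest → 3 ≤ multiplicity x D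
    -- Two occurrences of `x` would yield at most 2 · 4 neighbours; together with `x` this makes 9
    -- vertices, although the triples through 0 and `x` must reach all eleven.
    often {x} x∈ = ≮⇒≥ λ few → contradiction
      (≤-trans (unique-⊆⇒length≤ rest-unique near)
        (s≤s (≤-trans (length-concat-link x B B≤5 (allFin 6)) (*-monoʳ-≤ 4 (≤-pred few)))))
      (<⇒≱ (toWitness {a? = 9 <? 11} _))
      where
      near : ∀ {y} → y ∈ rest → y ∈ x ∷ concatMap (link x ∘ B) (allFin 6)
      near {y} y∈ with x ≟ y
      ... | yes refl = here refl
      ... | no x≢y with ∈-applyUpTo⁻ suc x∈ | ∈-applyUpTo⁻ suc y∈
      ...   | x′ , x< , refl | y′ , y< , refl
        with i , Ht ← distinct-covers {0} (λ ()) (λ ()) x≢y (s≤s z≤n) (s≤s x<) (s≤s y<)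
        with 0∈ , x∈B , y∈B ← block-⊆ Ht (inj₁ refl) =
        there (∈-concat-allFin (link x ∘ B) i (∈-link (∈-link 0∈ x∈B λ ()) (∈-link 0∈ y∈B λ ()) x≢y))

  module _ (i₀ : Fin 6) (sp : Split 12 (H i₀)) where
    open Split sp

    side : ℕ → Bool
    side x = does (x ∈? left)

    halves-list : List Tri
    halves-list = triples left ++ triples right

    halves-length : length halves-list ≡ 40
    halves-length = trans (length-++ (triples left))
      (cong₂ _+_ (length-triples-six left left-length) (length-triples-six right right-length))

    side-left : ∀ {x} → bit (side x) ≡ 1 → x ∈ left
    side-left {x} eq with x ∈? left
    ... | yes x∈ = x∈

    side-right : ∀ {x} → x < 12 → bit (side x) ≡ 0 → x ∈ right
    side-right {x} x< eq with x ∈? left | total x<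
    ... | no x∉ | inj₁ x∈ = contradiction x∈ x∉
    ... | no x∉ | inj₂ x∈ = x∈

    left-side : ∀ {x} → x ∈ left → bit (side x) ≡ 1
    left-side x∈ = cong bit (dec-true (_ ∈? left) x∈)

    right-side : ∀ {x} → x ∈ right → bit (side x) ≡ 0
    right-side x∈ = cong bit (dec-false (_ ∈? left) (λ x∈l → disjoint x∈l x∈))

    one-sided-monochromatic : ∀ {t} → H i₀ t → Monochromatic (mapᵗ (bit ∘ side) t)
    one-sided-monochromatic {tri a b c} Ht with one-sided Ht
    ... | inj₁ (a∈ , b∈ , c∈) =
      trans (left-side a∈) (sym (left-side b∈)) , trans (left-side b∈) (sym (left-side c∈))
    ... | inj₂ (a∈ , b∈ , c∈) =
      trans (right-side a∈) (sym (right-side b∈)) , trans (right-side b∈) (sym (right-side c∈))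

    -- 36 = 2 · 18 comes from the two six-sets of a split colour; a small colour has at most 35
    -- triples anyway.
    CrossingCover : Fin 6 → Set
    CrossingCover i = ∃[ N ] length N ≤ 36 ×
      (∀ {t} → H i t → ¬ Monochromatic (mapᵗ (bit ∘ side) t) → ∃[ u ] u ∈ N × t ∼ u)

    monochromatic-cover : ∀ {i t} → H i t → Monochromatic (mapᵗ (bit ∘ side) t) →
                          ∃[ u ] u ∈ halves-list × t ∼ u
    monochromatic-cover {i} {t@(tri a b c)} Ht (a≡b , b≡c) with proper Ht
    ... | p@((a< , b< , c<) , _) with side a in eq
    ...   | true  = let u , u∈ , t∼u = within p (side-left (cong bit eq) ,
                                                 side-left (sym a≡b) ,
                                                 side-left (trans (sym b≡c) (sym a≡b)))
                    in u , ∈-++⁺ˡ u∈ , t∼u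
    ...   | false = let u , u∈ , t∼u = within p (side-right a< (cong bit eq) ,
                                                 side-right b< (sym a≡b) ,
                                                 side-right c< (trans (sym b≡c) (sym a≡b)))
                    in u , ∈-++⁺ʳ (triples left) u∈ , t∼u

    crossing-cover : ∀ i → Small 35 (H i) ⊎ Split 12 (H i) → CrossingCover i
    crossing-cover i (inj₁ (L , L≤35 , H⊑L)) = L , m≤n⇒m≤1+n L≤35 , λ Ht _ → H⊑L Ht
    crossing-cover i (inj₂ sp′) = across (triples left′ ++ triples right′) , bound , covered
      where
      open Split sp′ using () renaming (left to left′; right to right′; left-length to left′-length;
                                        right-length to right′-length; one-sided to one-sided′)

      across : List Tri → List Tri
      across = crossing-along (bit ∘ side)

      bound : length (across (triples left′ ++ triples right′)) ≤ 36
      bound = ≤-trans (≤-reflexive (trans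
          (cong length (filter-++ (λ t → ¬? (monochromatic? (mapᵗ (bit ∘ side) t)))
                                  (triples left′) (triples right′)))
          (length-++ (across (triples left′)))))
        (+-mono-≤ (crossing-along≤18 side left′ left′-length)
                  (crossing-along≤18 side right′ right′-length))

      covered : ∀ {t} → H i t → ¬ Monochromatic (mapᵗ (bit ∘ side) t) →
                ∃[ u ] u ∈ across (triples left′ ++ triples right′) × t ∼ u
      covered Ht ¬mono = keep (Sum.map (within (proper Ht)) (within (proper Ht)) (one-sided′ Ht))
        where
        crosses : ∀ {u} → _ ∼ u → ¬ Monochromatic (mapᵗ (bit ∘ side) u)
        crosses t∼u = ¬mono ∘ Monochromatic-resp-∼ (∼-map _ (∼-sym t∼u))

        keep : (∃[ u ] u ∈ triples left′ × _ ∼ u) ⊎ (∃[ u ] u ∈ triples right′ × _ ∼ u) → _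
        keep (inj₁ (u , u∈ , t∼u)) = u , ∈-filter⁺ _ (∈-++⁺ˡ u∈) (crosses t∼u) , t∼u
        keep (inj₂ (u , u∈ , t∼u)) =
          u , ∈-filter⁺ _ (∈-++⁺ʳ (triples left′) u∈) (crosses t∼u) , t∼u

    -- The total 40 + 35 + 4 · 36 = 219 falls one short of C(12,3) = 220.
    others-split : (∀ i → Small 35 (H i) ⊎ Split 12 (H i)) → ∀ j → ¬ Small 35 (H (punchIn i₀ j))
    others-split o j (L₁ , L₁≤35 , H⊑L₁) = contradiction (≤-trans (cover col uniq sub) few)
      (<⇒≱ (toWitness {a? = 219 <? length (triples (upTo 12))} _))
      where
      cc : ∀ k → CrossingCover (punchIn i₀ (punchIn j k))
      cc k = crossing-cover _ (o _)

      N : Fin 4 → List Tri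
      N k = proj₁ (cc k)

      all-lists : List Tri
      all-lists = halves-list ++ L₁ ++ concatMap N (allFin 4)

      few : length all-lists ≤ 219
      few = ≤-trans (≤-reflexive (trans (length-++ halves-list)
                                        (cong (length halves-list +_) (length-++ L₁))))
        (+-mono-≤ (≤-reflexive halves-length)
          (+-mono-≤ L₁≤35 (length-concat-allFin≤ N (λ k → proj₁ (proj₂ (cc k))))))

      in-halves : ∀ {t} → ∃[ u ] u ∈ halves-list × t ∼ u → ∃[ u ] u ∈ all-lists × t ∼ u
      in-halves (u , u∈ , t∼u) = u , ∈-++⁺ˡ u∈ , t∼u

      sub : ∀ i → H i ⊑ all-lists
      -- A triple within a half of `i₀` is in `halves-list` whatever its colour. Across the halves,
      -- colour `i₀` does not occur, the small colour has `L₁`, and the four remaining colours have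
      -- the lists `N k`.
      sub i {t} Ht with monochromatic? (mapᵗ (bit ∘ side) t)
      ... | yes mono = in-halves (monochromatic-cover Ht mono)
      ... | no ¬mono with without i₀ i
      ...   | inj₁ refl = contradiction (one-sided-monochromatic Ht) ¬mono
      ...   | inj₂ (l , refl) with without j l
      ...     | inj₁ refl = let u , u∈ , t∼u = H⊑L₁ Ht in u , ∈-++⁺ʳ halves-list (∈-++⁺ˡ u∈) , t∼u
      ...     | inj₂ (k , refl) = let u , u∈ , t∼u = proj₂ (proj₂ (cc k)) Ht ¬mono in
                  u , ∈-++⁺ʳ halves-list (∈-++⁺ʳ L₁ (∈-concat-allFin N k u∈)) , t∼u

  star-twelve : ∀ {k} → Search.search 12 35 true k [] (triples (upTo 12)) ≡ true → ∃[ i ] Star (H i)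
  star-twelve {k} ok with splitFin starOrNot
    where
    starOrNot : ∀ i → Star (H i) ⊎ (Small 35 (H i) ⊎ Split 12 (H i))
    starOrNot i with outcome col {35} {true} {k} ok i
    ... | star x x∈     = inj₁ (x , x∈)
    ... | small L L≤ ⊑L = inj₂ (inj₁ (L , L≤ , ⊑L))
    ... | split _ sp    = inj₂ (inj₂ sp)
  ... | inj₁ found = found
  ... | inj₂ o with splitFin (Sum.swap ∘ o)
  -- Six small classes cover at most 6 · 35 = 210 of the 220 triples.
  ...   | inj₂ smalls = contradiction
    (≤-trans (cover-smalls col uniq smalls) (toWitness {a? = 210 ≤? 219} _))
    (<⇒≱ (toWitness {a? = 219 <? length (triples (upTo 12))} _))
  ...   | inj₁ (i₀ , sp) = contradiction all-split not-all-split
    where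
    all-split : ∀ i → Split 12 (H i)
    all-split i with without i₀ i
    ... | inj₁ refl = sp
    ... | inj₂ (j , refl) with o (punchIn i₀ j)
    ...   | inj₂ sp′  = sp′
    ...   | inj₁ sm = contradiction sm (others-split i₀ sp o j)

-- Three-element subsets

∣⁅x⁆∪p∣≤1+∣p∣ : ∀ {n} (x : Fin n) p → ∣ ⁅ x ⁆ ∪ p ∣ ≤ suc ∣ p ∣
∣⁅x⁆∪p∣≤1+∣p∣ zero    (inside  ∷ p) rewrite ∪-identityˡ p = m≤n⇒m≤1+n (≤-reflexive refl)
∣⁅x⁆∪p∣≤1+∣p∣ zero    (outside ∷ p) rewrite ∪-identityˡ p = ≤-reflexive refl
∣⁅x⁆∪p∣≤1+∣p∣ (suc x) (inside  ∷ p) = s≤s (∣⁅x⁆∪p∣≤1+∣p∣ x p)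
∣⁅x⁆∪p∣≤1+∣p∣ (suc x) (outside ∷ p) = ∣⁅x⁆∪p∣≤1+∣p∣ x p

x∉p⇒∣⁅x⁆∪p∣≡1+∣p∣ : ∀ {n} {x : Fin n} {p} → ¬ x ∈ˢ p → ∣ ⁅ x ⁆ ∪ p ∣ ≡ suc ∣ p ∣
x∉p⇒∣⁅x⁆∪p∣≡1+∣p∣ {x = zero}  {inside  ∷ p} x∉p = contradiction here x∉p
x∉p⇒∣⁅x⁆∪p∣≡1+∣p∣ {x = zero}  {outside ∷ p} x∉p = cong (suc ∘ ∣_∣) (∪-identityˡ p)
x∉p⇒∣⁅x⁆∪p∣≡1+∣p∣ {x = suc x} {inside  ∷ p} x∉p = cong suc (x∉p⇒∣⁅x⁆∪p∣≡1+∣p∣ (x∉p ∘ there))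
x∉p⇒∣⁅x⁆∪p∣≡1+∣p∣ {x = suc x} {outside ∷ p} x∉p = x∉p⇒∣⁅x⁆∪p∣≡1+∣p∣ (x∉p ∘ there)

pop : ∀ {n k} (p : Subset n) → ∣ p ∣ ≡ suc k → ∃[ x ] ∃[ q ] ∣ q ∣ ≡ k × p ≡ ⁅ x ⁆ ∪ q
pop (inside  ∷ p) refl = zero , outside ∷ p , refl , cong (inside ∷_) (sym (∪-identityˡ p))
pop (outside ∷ p) eq with x , q , ∣q∣ , refl ← pop p eq = suc x , outside ∷ q , ∣q∣ , refl

∣p∣≡0⇒p≡∅ : ∀ {n} (p : Subset n) → ∣ p ∣ ≡ 0 → p ≡ ∅
∣p∣≡0⇒p≡∅ []            eq = refl
∣p∣≡0⇒p≡∅ (outside ∷ p) eq = cong (outside ∷_) (∣p∣≡0⇒p≡∅ p eq)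

edge : ∀ {n} → Fin n → Fin n → Fin n → Subset n
edge i j k = ⁅ i ⁆ ∪ ⁅ j ⁆ ∪ ⁅ k ⁆

edge-flip₁₂ : ∀ {n} (i j k : Fin n) → edge i j k ≡ edge j i k
edge-flip₁₂ i j k = trans (sym (∪-assoc ⁅ i ⁆ ⁅ j ⁆ ⁅ k ⁆))
  (trans (cong (_∪ ⁅ k ⁆) (∪-comm ⁅ i ⁆ ⁅ j ⁆)) (∪-assoc ⁅ j ⁆ ⁅ i ⁆ ⁅ k ⁆))

edge-flip₂₃ : ∀ {n} (i j k : Fin n) → edge i j k ≡ edge i k j
edge-flip₂₃ i j k = cong (⁅ i ⁆ ∪_) (∪-comm ⁅ j ⁆ ⁅ k ⁆)

toEdge : ∀ {n} (p : Subset n) → ∣ p ∣ ≡ 3 → ∃[ i ] ∃[ j ] ∃[ k ] p ≡ edge i j k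
toEdge p eq
  with i , q , eq₁ , refl ← pop p eq
  with j , q′ , eq₂ , refl ← pop q eq₁
  with k , q″ , eq₃ , refl ← pop q′ eq₂
  rewrite ∣p∣≡0⇒p≡∅ q″ eq₃ = i , j , k , cong (λ q → ⁅ i ⁆ ∪ ⁅ j ⁆ ∪ q) (∪-identityʳ ⁅ k ⁆)

∈-edge⁺ : ∀ {n} {x i j k : Fin n} → x ≡ i ⊎ x ≡ j ⊎ x ≡ k → x ∈ˢ edge i j k
∈-edge⁺ (inj₁ refl)        = x∈p∪q⁺ (inj₁ (x∈⁅x⁆ _))
∈-edge⁺ (inj₂ (inj₁ refl)) = x∈p∪q⁺ (inj₂ (x∈p∪q⁺ (inj₁ (x∈⁅x⁆ _))))
∈-edge⁺ (inj₂ (inj₂ refl)) = x∈p∪q⁺ (inj₂ (x∈p∪q⁺ (inj₂ (x∈⁅x⁆ _))))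

∈-edge⁻ : ∀ {n} {x : Fin n} i j k → x ∈ˢ edge i j k → x ≡ i ⊎ x ≡ j ⊎ x ≡ k
∈-edge⁻ i j k =
  Sum.map (x∈⁅y⁆⇒x≡y i) (Sum.map (x∈⁅y⁆⇒x≡y j) (x∈⁅y⁆⇒x≡y k) ∘ x∈p∪q⁻ ⁅ j ⁆ ⁅ k ⁆) ∘
  x∈p∪q⁻ ⁅ i ⁆ _

edge-image : ∀ {m n} (f : Fin m → Fin n) i j k → IsImage f (edge i j k) (edge (f i) (f j) (f k))
edge-image f i j k y = mk⇔ to from
  where
  to : y ∈ˢ edge (f i) (f j) (f k) → ∃[ x ] x ∈ˢ edge i j k × f x ≡ y
  to y∈ with ∈-edge⁻ (f i) (f j) (f k) y∈
  ... | inj₁ refl        = i , ∈-edge⁺ (inj₁ refl) , refl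
  ... | inj₂ (inj₁ refl) = j , ∈-edge⁺ (inj₂ (inj₁ refl)) , refl
  ... | inj₂ (inj₂ refl) = k , ∈-edge⁺ (inj₂ (inj₂ refl)) , refl

  from : (∃[ x ] x ∈ˢ edge i j k × f x ≡ y) → y ∈ˢ edge (f i) (f j) (f k)
  from (x , x∈ , refl) = ∈-edge⁺ (Sum.map (cong f) (Sum.map (cong f) (cong f)) (∈-edge⁻ i j k x∈))

∣edge∣≡3 : ∀ {n} {i j k : Fin n} → i ≢ j → i ≢ k → j ≢ k → ∣ edge i j k ∣ ≡ 3
∣edge∣≡3 {i = i} {j} {k} i≢j i≢k j≢k = trans (x∉p⇒∣⁅x⁆∪p∣≡1+∣p∣ i∉)
  (cong suc (trans (x∉p⇒∣⁅x⁆∪p∣≡1+∣p∣ (j≢k ∘ x∈⁅y⁆⇒x≡y k)) (cong suc (∣⁅x⁆∣≡1 k))))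
  where
  i∉ : ¬ i ∈ˢ ⁅ j ⁆ ∪ ⁅ k ⁆
  i∉ i∈ with x∈p∪q⁻ ⁅ j ⁆ ⁅ k ⁆ i∈
  ... | inj₁ i∈j = i≢j (x∈⁅y⁆⇒x≡y j i∈j)
  ... | inj₂ i∈k = i≢k (x∈⁅y⁆⇒x≡y k i∈k)

-- A repeated entry collapses the union to at most two elements. The other two inequalities come
-- from this one by swaps.
∣edge∣≡3⇒≢ : ∀ {n} (i j k : Fin n) → ∣ edge i j k ∣ ≡ 3 → i ≢ j
∣edge∣≡3⇒≢ i .i k eq refl = contradiction
  (≤-trans (≤-reflexive (trans (sym eq) (cong ∣_∣ collapse)))
    (≤-trans (∣⁅x⁆∪p∣≤1+∣p∣ i ⁅ k ⁆) (s≤s (≤-reflexive (∣⁅x⁆∣≡1 k)))))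
  (<⇒≱ (toWitness {a? = 2 <? 3} _))
  where
  collapse : edge i i k ≡ ⁅ i ⁆ ∪ ⁅ k ⁆
  collapse = trans (sym (∪-assoc ⁅ i ⁆ ⁅ i ⁆ ⁅ k ⁆)) (cong (_∪ ⁅ k ⁆) (∪-idem ⁅ i ⁆))

-- From colour classes to path-free 3-graphs

module _ {n r : ℕ} (χ : Colouring n r) (c : Fin r) where

  Coloured : Fin n → Fin n → Fin n → Set
  Coloured i j k = Σ[ eq ∈ ∣ edge i j k ∣ ≡ 3 ] χ (edge i j k , eq) ≡ c

  coloured? : ∀ i j k → Dec (Coloured i j k)
  coloured? i j k with ∣ edge i j k ∣ ≟ 3
  ... | no ≢3 = no (≢3 ∘ proj₁)
  ... | yes eq with χ (edge i j k , eq) Fin.≟ c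
  ...   | yes χ≡c = yes (eq , χ≡c)
  -- The proof of size is part of the edge that `χ` receives, so two such proofs have to be
  -- identified.
  ...   | no  χ≢c = no λ (eq′ , χ≡c) →
    χ≢c (subst (λ eq → χ (edge i j k , eq) ≡ c) (≡-irrelevant eq′ eq) χ≡c)

  coloured-flip₁₂ : ∀ {i j k} → Coloured i j k → Coloured j i k
  coloured-flip₁₂ {i} {j} {k} = subst (λ e → Σ[ eq ∈ ∣ e ∣ ≡ 3 ] χ (e , eq) ≡ c) (edge-flip₁₂ i j k)

  coloured-flip₂₃ : ∀ {i j k} → Coloured i j k → Coloured i k j
  coloured-flip₂₃ {i} {j} {k} = subst (λ e → Σ[ eq ∈ ∣ e ∣ ≡ 3 ] χ (e , eq) ≡ c) (edge-flip₂₃ i j k)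

  coloured-distinct : ∀ {i j k} → Coloured i j k → i ≢ j × i ≢ k × j ≢ k
  coloured-distinct {i} {j} {k} col =
    ∣edge∣≡3⇒≢ i j k (proj₁ col) ,
    ∣edge∣≡3⇒≢ i k j (proj₁ (coloured-flip₂₃ col)) ,
    ∣edge∣≡3⇒≢ j k i (proj₁ (coloured-flip₂₃ (coloured-flip₁₂ col)))

  Class : Tri → Set
  Class (tri x y z) = ∃[ i ] ∃[ j ] ∃[ k ] (x ≡ toℕ i × y ≡ toℕ j × z ≡ toℕ k) × Coloured i j k

  class? : ∀ t → Dec (Class t)
  class? (tri x y z) = Fin.any? λ i → Fin.any? λ j → Fin.any? λ k →
    (x ≟ toℕ i ×-dec y ≟ toℕ j ×-dec z ≟ toℕ k) ×-dec coloured? i j k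

  class-resp-∼ : ∀ {t u} → t ∼ u → Class t → Class u
  class-resp-∼ ∼-refl        cl = cl
  class-resp-∼ (∼-trans p q) cl = class-resp-∼ q (class-resp-∼ p cl)
  class-resp-∼ flip₁₂ (i , j , k , (x≡ , y≡ , z≡) , col) =
    j , i , k , (y≡ , x≡ , z≡) , coloured-flip₁₂ col
  class-resp-∼ flip₂₃ (i , j , k , (x≡ , y≡ , z≡) , col) =
    i , k , j , (x≡ , z≡ , y≡) , coloured-flip₂₃ col

  class-proper : ∀ {t} → Class t → Proper n t
  class-proper {tri _ _ _} (i , j , k , (refl , refl , refl) , col)
    with i≢j , i≢k , j≢k ← coloured-distinct col =
    (toℕ<n i , toℕ<n j , toℕ<n k) , i≢j ∘ toℕ-injective , i≢k ∘ toℕ-injective , j≢k ∘ toℕ-injective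

  class-in-range : Class ⊑ triples (upTo n)
  class-in-range {tri _ _ _} cl with (a< , b< , c<) , a≢b , a≢c , b≢c ← class-proper cl =
    ∈-triples a≢b a≢c b≢c (∈-upTo⁺ a<) (∈-upTo⁺ b<) (∈-upTo⁺ c<)

  record PathOn (vs : Vec (Fin n) 7) : Set where
    constructor pathOn
    field
      unique : Vec.Unique vs
      abc    : Coloured (lookup vs 0F) (lookup vs 1F) (lookup vs 2F)
      cde    : Coloured (lookup vs 2F) (lookup vs 3F) (lookup vs 4F)
      efg    : Coloured (lookup vs 4F) (lookup vs 5F) (lookup vs 6F)

  pathOn? : ∀ vs → Dec (PathOn vs)
  pathOn? vs =
    map′ (λ (u , p , q , s) → pathOn u p q s) (λ (pathOn u p q s) → u , p , q , s)
      (allPairs? (λ i j → ¬? (i Fin.≟ j)) vs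
        ×-dec coloured? (lookup vs 0F) (lookup vs 1F) (lookup vs 2F)
        ×-dec coloured? (lookup vs 2F) (lookup vs 3F) (lookup vs 4F)
        ×-dec coloured? (lookup vs 4F) (lookup vs 5F) (lookup vs 6F))

  -- Makes the existence of a monochromatic path decidable, so that the dichotomy `pathFree-or-copy`
  -- is constructive.
  anyVec? : ∀ {m} {Q : Vec (Fin n) m → Set} → (∀ v → Dec (Q v)) → Dec (∃ Q)
  anyVec? {zero}  Q? with Q? []
  ... | yes q = yes ([] , q)
  ... | no ¬q = no λ { ([] , q) → ¬q q }
  anyVec? {suc m} Q? with Fin.any? (λ i → anyVec? (Q? ∘ (i ∷_)))
  ... | yes (i , v , q) = yes (i ∷ v , q)
  ... | no ¬q = no λ { (i ∷ v , q) → ¬q (i , v , q) }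

  path⇒copy : ∀ {vs} → PathOn vs → ColourClass χ c ContainsCopyOf P
  path⇒copy {vs} (pathOn unique abc cde efg) = lookup vs , lookup-injective unique _ _ , edges
    where
    edges : ∀ e → P e → ∃[ e′ ] ColourClass χ c e′ × IsImage (lookup vs) (proj₁ e) (proj₁ e′)
    edges _ (here refl) =
      (_ , proj₁ abc) , proj₂ abc , edge-image (lookup vs) 0F 1F 2F
    edges _ (there (here refl)) =
      (_ , proj₁ cde) , proj₂ cde , edge-image (lookup vs) 2F 3F 4F
    edges _ (there (there (here refl))) =
      (_ , proj₁ efg) , proj₂ efg , edge-image (lookup vs) 4F 5F 6F

  rotate : ∀ {t x} → Class t → x ∈ᵗ t →
           ∃[ i ] ∃[ j ] ∃[ k ] toℕ k ≡ x × tri (toℕ i) (toℕ j) (toℕ k) ∼ t × Coloured i j k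
  rotate {tri _ _ _} (i , j , k , (refl , refl , refl) , col) (inj₁ refl) =
    j , k , i , refl , ∼-trans flip₂₃ flip₁₂ , coloured-flip₂₃ (coloured-flip₁₂ col)
  rotate {tri _ _ _} (i , j , k , (refl , refl , refl) , col) (inj₂ (inj₁ refl)) =
    i , k , j , refl , flip₂₃ , coloured-flip₂₃ col
  rotate {tri _ _ _} (i , j , k , (refl , refl , refl) , col) (inj₂ (inj₂ refl)) =
    i , j , k , refl , ∼-refl , col

  -- The middle edge of a path with its joints moved to the ends.
  joints : ∀ {t x z} → Class t → x ∈ᵗ t → z ∈ᵗ t → x ≢ z →
           ∃[ i ] ∃[ j ] ∃[ k ] toℕ i ≡ x × toℕ k ≡ z × tri (toℕ i) (toℕ j) (toℕ k) ∼ t × Coloured i j k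
  joints cl x∈ z∈ x≢z with i , j , k , refl , ijk∼t , col ← rotate cl z∈
    with ∈ᵗ-resp-∼ (∼-sym ijk∼t) x∈
  ... | inj₁ refl        = i , j , k , refl , refl , ijk∼t , col
  ... | inj₂ (inj₁ refl) = j , i , k , refl , refl , ∼-trans flip₁₂ ijk∼t , coloured-flip₁₂ col
  ... | inj₂ (inj₂ refl) = contradiction refl x≢z

  -- Vertices of one edge differ because it has size three, those of consecutive edges because the
  -- joint is their only common vertex, and those of the end edges because these are disjoint.
  path : ∀ {t u v} → Class t → Class u → Class v → Meet t u → Meet u v → Disjoint t v → ∃ PathOn
  path {t} {u} {v} Ct Cu Cv (x , x∈t , x∈u , only-x) (z , z∈u , z∈v , only-z) t∥v
    with a , b , c , refl , abc∼ , abc ← rotate Ct x∈t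
    with f , g , e , refl , fge∼ , fge ← rotate Cv z∈v
    with c′ , d , e′ , c′≡c , e′≡e , cde∼ , cde ←
           joints Cu x∈u z∈u (λ x≡z → t∥v x∈t (subst (_∈ᵗ v) (sym x≡z) z∈v))
    with refl ← toℕ-injective c′≡c
    with refl ← toℕ-injective e′≡e = a ∷ b ∷ c ∷ d ∷ e ∷ f ∷ g ∷ [] , pathOn
      ( (a≢b ∷ a≢c ∷ tu a∈ a≢c d∈ ∷ tu a∈ a≢c e∈ ∷ tv a∈ f∈ ∷ tv a∈ g∈ ∷ [])
      ∷ (b≢c ∷ tu b∈ b≢c d∈ ∷ tu b∈ b≢c e∈ ∷ tv b∈ f∈ ∷ tv b∈ g∈ ∷ [])
      ∷ (c≢d ∷ c≢e ∷ uv c∈ c≢e f∈ ∷ uv c∈ c≢e g∈ ∷ [])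
      ∷ (d≢e ∷ uv d∈ d≢e f∈ ∷ uv d∈ d≢e g∈ ∷ [])
      ∷ (≢-sym f≢e ∷ ≢-sym g≢e ∷ [])
      ∷ (f≢g ∷ [])
      ∷ [] ∷ []) abc cde (coloured-flip₁₂ (coloured-flip₂₃ fge))
    where
    abc-distinct = coloured-distinct abc
    cde-distinct = coloured-distinct cde
    fge-distinct = coloured-distinct fge
    a≢b = proj₁ abc-distinct
    a≢c = proj₁ (proj₂ abc-distinct)
    b≢c = proj₂ (proj₂ abc-distinct)
    c≢d = proj₁ cde-distinct
    c≢e = proj₁ (proj₂ cde-distinct)
    d≢e = proj₂ (proj₂ cde-distinct)
    f≢g = proj₁ fge-distinct
    f≢e = proj₁ (proj₂ fge-distinct)
    g≢e = proj₂ (proj₂ fge-distinct)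
    a∈ = ∈ᵗ-resp-∼ abc∼ (inj₁ refl)
    b∈ = ∈ᵗ-resp-∼ abc∼ (inj₂ (inj₁ refl))
    c∈ = ∈ᵗ-resp-∼ cde∼ (inj₁ refl)
    d∈ = ∈ᵗ-resp-∼ cde∼ (inj₂ (inj₁ refl))
    e∈ = ∈ᵗ-resp-∼ cde∼ (inj₂ (inj₂ refl))
    f∈ = ∈ᵗ-resp-∼ fge∼ (inj₁ refl)
    g∈ = ∈ᵗ-resp-∼ fge∼ (inj₂ (inj₁ refl))

    tu : ∀ {i j} → toℕ i ∈ᵗ t → i ≢ c → toℕ j ∈ᵗ u → i ≢ j
    tu i∈ i≢c j∈ refl = i≢c (toℕ-injective (only-x i∈ j∈))

    uv : ∀ {i j} → toℕ i ∈ᵗ u → i ≢ e → toℕ j ∈ᵗ v → i ≢ j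
    uv i∈ i≢e j∈ refl = i≢e (toℕ-injective (only-z i∈ j∈))

    tv : ∀ {i j} → toℕ i ∈ᵗ t → toℕ j ∈ᵗ v → i ≢ j
    tv i∈ j∈ refl = t∥v i∈ j∈

pathFree-or-copy : ∀ {n r} (χ : Colouring n r) → HasMonochromatic P χ ⊎ PathFreeColouring n r (Class χ)
pathFree-or-copy {n} {r} χ with Fin.any? (λ c → anyVec? χ c (pathOn? χ c))
... | yes (c , _ , p) = inj₁ (c , path⇒copy χ c p)
... | no none = inj₂ record
  { isPathFree = λ c → record
    { resp-∼   = class-resp-∼ χ c
    ; edge?    = class? χ c
    ; pathFree = λ Ct Cu Cv tu uv tv → none (c , path χ c Ct Cu Cv tu uv tv)
    }
  ; inRange = class-in-range χ
  ; covers  = covers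
  }
  where
  covers : ∀ {t} → t ∈ triples (upTo n) → ∃[ c ] Class χ c t
  covers {tri _ _ _} t∈ with (a< , b< , c<) , a≢b , a≢c , b≢c ← triples-proper t∈ =
    _ , fromℕ< a< , fromℕ< b< , fromℕ< c< ,
    (sym (toℕ-fromℕ< a<) , sym (toℕ-fromℕ< b<) , sym (toℕ-fromℕ< c<)) ,
    ∣edge∣≡3 (a≢b ∘ Fin.fromℕ<-injective _ _ a< b<) (a≢c ∘ Fin.fromℕ<-injective _ _ a< c<)
             (b≢c ∘ Fin.fromℕ<-injective _ _ b< c<) ,
    refl

-- Deleting the centre of a star

StarAt : ∀ {n r} → Colouring n r → Fin r → Fin n → Set
StarAt χ c x = ∀ e → χ e ≡ c → x ∈ˢ proj₁ e

star⇒starAt : ∀ {n r} (χ : Colouring (suc n) r) c → Star (Class χ c) → ∃ (StarAt χ c)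
star⇒starAt {n} χ c (x , x∈) with x <? suc n
... | yes x< = fromℕ< x< , at
  where
  at : StarAt χ c (fromℕ< x<)
  at (e , eq) χe≡c with i , j , k , refl ← toEdge e eq =
    ∈-edge⁺ (Sum.map down (Sum.map down down) (x∈ (i , j , k , (refl , refl , refl) , eq , χe≡c)))
    where
    down : ∀ {l} → x ≡ toℕ l → fromℕ< x< ≡ l
    down x≡ = toℕ-injective (trans (toℕ-fromℕ< x<) x≡)
-- A centre out of range forces the class to be empty, and then vertex zero is vacuously a centre.
... | no x≮ = zero , at
  where
  at : StarAt χ c zero
  at (e , eq) χe≡c with i , j , k , refl ← toEdge e eq =
    contradiction (subst (_< suc n)  (sym (proj₂ bound)) (toℕ<n (proj₁ bound))) x≮
    where
    bound : ∃[ l ] x ≡ toℕ l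
    bound with x∈ (i , j , k , (refl , refl , refl) , eq , χe≡c)
    ... | inj₁ x≡        = i , x≡
    ... | inj₂ (inj₁ x≡) = j , x≡
    ... | inj₂ (inj₂ x≡) = k , x≡

∣insertAt-outside∣ : ∀ {n} (p : Subset n) x → ∣ insertAt p x outside ∣ ≡ ∣ p ∣
∣insertAt-outside∣ p             zero    = refl
∣insertAt-outside∣ (inside  ∷ p) (suc x) = cong suc (∣insertAt-outside∣ p x)
∣insertAt-outside∣ (outside ∷ p) (suc x) = ∣insertAt-outside∣ p x

module _ {n r} (χ : Colouring (suc n) (suc r)) (c : Fin (suc r)) (x : Fin (suc n))
         (centred : StarAt χ c x) where

  lift : Triple n → Triple (suc n)
  lift (e , eq) = insertAt e x outside , trans (∣insertAt-outside∣ e x) eq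

  x∉lift : ∀ e → ¬ x ∈ˢ proj₁ (lift e)
  x∉lift (e , _) x∈ with () ← trans (sym (insertAt-lookup e x outside)) ([]=⇒lookup x∈)

  c≢lift : ∀ e → c ≢ χ (lift e)
  c≢lift e c≡ = x∉lift e (centred (lift e) (sym c≡))

  -- A lifted edge avoids the centre and so does not have colour `c`, which can be removed from the
  -- palette.
  restrict : Colouring n r
  restrict e = punchOut (c≢lift e)

  lift-image : ∀ {m} {f : Fin m → Fin n} {S} e → IsImage f S (proj₁ e) →
               IsImage (punchIn x ∘ f) S (proj₁ (lift e))
  lift-image {f = f} {S} E@(e , _) image y = mk⇔ to from
    where
    to : y ∈ˢ insertAt e x outside → ∃[ i ] i ∈ˢ S × punchIn x (f i) ≡ y
    to y∈ with x Fin.≟ y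
    ... | yes refl = contradiction y∈ (x∉lift E)
    ... | no x≢y
      with i , i∈ , refl′ ← Equivalence.to (image (punchOut x≢y)) (lookup⇒[]= _ e
             (trans (sym (insertAt-punchIn e x outside (punchOut x≢y)))
               (trans (cong (lookup (insertAt e x outside)) (Fin.punchIn-punchOut x≢y))
                 ([]=⇒lookup y∈)))) =
      i , i∈ , trans (cong (punchIn x) refl′) (Fin.punchIn-punchOut x≢y)

    from : (∃[ i ] i ∈ˢ S × punchIn x (f i) ≡ y) → y ∈ˢ insertAt e x outside
    from (i , i∈ , refl) = lookup⇒[]= _ _ (trans (insertAt-punchIn e x outside (f i))
      ([]=⇒lookup (Equivalence.from (image (f i)) (i , i∈ , refl))))

  restrict-copy : ∀ {m} {G : 3-Graph m} → HasMonochromatic G restrict → HasMonochromatic G χ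
  restrict-copy (d , f , f-injective , edges) =
    punchIn c d , punchIn x ∘ f , f-injective ∘ Fin.punchIn-injective x _ _ , λ e Ge →
      let e′ , χe′≡d , image = edges e Ge in
      lift e′ , trans (sym (Fin.punchIn-punchOut (c≢lift e′))) (cong (punchIn c) χe′≡d) ,
      lift-image e′ image

-- The seven searches and the upper bound

-- The fuel is ample: no branch of the seven searches is longer than a few hundred steps.
fuel : ℕ
fuel = 1000

-- Stated as an equation so that `refl` makes the type checker run the search.
Exhausted : ℕ → ℕ → Bool → Set
Exhausted n B twins = Search.search n B twins fuel [] (triples (upTo n)) ≡ true

exhausted-7 : Exhausted 7 34 false
exhausted-7 = refl

exhausted-8 : Exhausted 8 27 false
exhausted-8 = refl

exhausted-9 : Exhausted 9 27 false
exhausted-9 = refl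

exhausted-10 : Exhausted 10 29 false
exhausted-10 = refl

exhausted-11 : Exhausted 11 32 false
exhausted-11 = refl

exhausted-12 : Exhausted 12 35 true
exhausted-12 = refl

exhausted-13 : Exhausted 13 40 false
exhausted-13 = refl

keys-unique : ∀ n {_ : True (unique? (map key (triples (upTo n))))} →
              Unique (map key (triples (upTo n)))
keys-unique n {ok} = toWitness ok

-- Each comparison sets `r * B` against C(r + 6, 3). For `r` equal to 6 two disjoint K_6 spoil plain
-- counting, as 6 · 40 > 220.
star-class : ∀ r {H : Fin r → Tri → Set} → 1 ≤ r → r ≤ 7 → PathFreeColouring (r + 6) r H →
             ∃[ c ] Star (H c)
star-class 1 _ _ col =
  star-by-counting {7} col {34} {fuel} exhausted-7 (keys-unique 7) (from-yes (34 <? 35))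
star-class 2 _ _ col =
  star-by-counting {8} col {27} {fuel} exhausted-8 (keys-unique 8) (from-yes (54 <? 56))
star-class 3 _ _ col =
  star-by-counting {9} col {27} {fuel} exhausted-9 (keys-unique 9) (from-yes (81 <? 84))
star-class 4 _ _ col =
  star-by-counting {10} col {29} {fuel} exhausted-10 (keys-unique 10) (from-yes (116 <? 120))
star-class 5 _ _ col =
  star-by-counting {11} col {32} {fuel} exhausted-11 (keys-unique 11) (from-yes (160 <? 165))
star-class 6 _ _ col = Twelve.star-twelve col (keys-unique 12) {fuel} exhausted-12
star-class 7 _ _ col =
  star-by-counting {13} col {40} {fuel} exhausted-13 (keys-unique 13) (from-yes (280 <? 286))
star-class (suc (suc (suc (suc (suc (suc (suc (suc _)))))))) _
  (s≤s (s≤s (s≤s (s≤s (s≤s (s≤s (s≤s ()))))))) _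

delete-star : ∀ {r} (χ : Colouring (suc r + 6) (suc r)) → Forces P r (r + 6) →
              ∃[ c ] Star (Class χ c) → HasMonochromatic P χ
delete-star χ force (c , st) =
  let x , centred = star⇒starAt χ c st in restrict-copy χ c x centred (force (restrict χ c x centred))

forces : ∀ r → r ≤ 7 → Forces P r (r + 6)
-- Six vertices span an edge but there is no colour for it, so the induction can start here
-- vacuously.
forces zero    _   χ = contradiction (χ (edge 0F 1F 2F , refl)) λ ()
forces (suc r) r<7 χ =
  Sum.[ id , delete-star χ (forces r (<⇒≤ r<7)) ∘ star-class (suc r) (s≤s z≤n) r<7 ]′
    (pathFree-or-copy χ)

-- The lower bound

first : ∀ {n} → Subset n → ℕ
first []            = 0
first (inside  ∷ p) = 0
first (outside ∷ p) = suc (first p)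

first-minimal : ∀ {n} {p : Subset n} {x} → x ∈ˢ p → first p ≤ toℕ x
first-minimal {p = inside  ∷ p} here      = z≤n
first-minimal {p = inside  ∷ p} (there _) = z≤n
first-minimal {p = outside ∷ p} (there x∈) = s≤s (first-minimal x∈)

first-member : ∀ {n k} (p : Subset n) → ∣ p ∣ ≡ suc k → ∃[ x ] x ∈ˢ p × toℕ x ≡ first p
first-member (inside  ∷ p) _  = zero , here , refl
first-member (outside ∷ p) eq with x , x∈ , x≡ ← first-member p eq = suc x , there x∈ , cong suc x≡

-- Carries a bound on the vertices of edges over to every vertex of a copy of `P`.
covered-by-edge : ∀ i → ∃[ e ] P e × i ∈ˢ proj₁ e
covered-by-edge 0F = _ , here refl , from-yes (0F ∈ˢ? edge 0F 1F 2F)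
covered-by-edge 1F = _ , here refl , from-yes (1F ∈ˢ? edge 0F 1F 2F)
covered-by-edge 2F = _ , here refl , from-yes (2F ∈ˢ? edge 0F 1F 2F)
covered-by-edge 3F = _ , there (here refl) , from-yes (3F ∈ˢ? edge 2F 3F 4F)
covered-by-edge 4F = _ , there (here refl) , from-yes (4F ∈ˢ? edge 2F 3F 4F)
covered-by-edge 5F = _ , there (there (here refl)) , from-yes (5F ∈ˢ? edge 4F 5F 6F)
covered-by-edge 6F = _ , there (there (here refl)) , from-yes (6F ∈ˢ? edge 4F 5F 6F)

ends-disjoint : ∀ (i : Fin 7) → i ∈ˢ edge 0F 1F 2F → ¬ i ∈ˢ edge 4F 5F 6F
ends-disjoint i i∈abc i∈efg with ∈-edge⁻ 0F 1F 2F i∈abc | ∈-edge⁻ 4F 5F 6F i∈efg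
... | inj₁ refl        | inj₂ (inj₁ ())
... | inj₁ refl        | inj₂ (inj₂ ())
... | inj₂ (inj₁ refl) | inj₂ (inj₁ ())
... | inj₂ (inj₁ refl) | inj₂ (inj₂ ())
... | inj₂ (inj₂ refl) | inj₂ (inj₁ ())
... | inj₂ (inj₂ refl) | inj₂ (inj₂ ())

module _ (m : ℕ) {n : ℕ} (n≤m+6 : n ≤ m + 6) where

  -- With `r` written as `suc m`, the bound on `n` reads `n ≤ r + 5`. Least vertices from `m` on
  -- share the last colour.
  byFirst : Colouring n (suc m)
  byFirst (e , _) = fromℕ< {first e ⊓ m} (s≤s (m⊓n≤n (first e) m))

  -- In a class below m all edges share their first vertex, which the disjoint end edges of
  -- P forbid; the class m lives on the last six vertices.
  byFirst-avoids-P : ¬ HasMonochromatic P byFirst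
  byFirst-avoids-P (c , f , f-injective , edges) with toℕ c <? m
  ... | yes c<m = ends-meet
    where
    first≡c : ∀ {e} → byFirst e ≡ c → first (proj₁ e) ≡ toℕ c
    first≡c {e , _} refl with ≤-total (first e) m
    ... | inj₁ first≤m = trans (sym (m≤n⇒m⊓n≡m first≤m)) (sym (toℕ-fromℕ< _))
    ... | inj₂ m≤first = contradiction
      (subst (_< m) (trans (toℕ-fromℕ< _) (m≥n⇒m⊓n≡n m≤first)) c<m) (n≮n m)

    common : ∀ e → P e → ∃[ i ] i ∈ˢ proj₁ e × toℕ (f i) ≡ toℕ c
    common e Pe
      with e′ , χe′≡c , image ← edges e Pe
      with x , x∈ , x≡ ← first-member (proj₁ e′) (proj₂ e′)
      with i , i∈ , refl ← Equivalence.to (image x) x∈ = i , i∈ , trans x≡ (first≡c {e′} χe′≡c)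

    ends-meet : ⊥
    ends-meet
      with i , i∈ , fi≡c ← common _ (here refl)
      with j , j∈ , fj≡c ← common _ (there (there (here refl)))
      with refl ← f-injective (toℕ-injective (trans fi≡c (sym fj≡c))) =
      ends-disjoint i i∈ j∈
  ... | no c≮m = contradiction (injective⇒≤ {f = shifted} shifted-injective) (from-no (7 ≤? 6))
    where
    m≤f : ∀ i → m ≤ toℕ (f i)
    m≤f i
      with e , Pe , i∈ ← covered-by-edge i
      with e′ , refl , image ← edges e Pe =
      ≤-trans (≤-trans (≮⇒≥ c≮m) (≤-trans (≤-reflexive (toℕ-fromℕ< _)) (m⊓n≤m (first (proj₁ e′)) m)))
        (first-minimal (Equivalence.from (image (f i)) (i , i∈ , refl)))

    shift< : ∀ i → toℕ (f i) ∸ m < 6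
    shift< i = +-cancelˡ-< m _ _
      (subst (_< m + 6) (sym (m+[n∸m]≡n (m≤f i))) (≤-trans (toℕ<n (f i)) n≤m+6))

    shifted : Fin 7 → Fin 6
    shifted i = fromℕ< (shift< i)

    shifted-injective : ∀ {i j} → shifted i ≡ shifted j → i ≡ j
    shifted-injective {i} {j} eq = f-injective (toℕ-injective (∸-cancelʳ-≡ (m≤f i) (m≤f j)
      (Fin.fromℕ<-injective _ _ (shift< i) (shift< j) eq)))

theorem1 : ∀ (r : ℕ) → 1 ≤ r → r ≤ 7 → IsRamseyNumber P r (r + 6)
theorem1 (suc m) 1≤r r≤7 = forces (suc m) r≤7 , λ n forced →
  -- The strict inequality `m + 6 < n` unfolds to the goal `suc m + 6 ≤ n`.
  ≰⇒> λ n≤m+6 → byFirst-avoids-P m n≤m+6 (forced (byFirst m n≤m+6))
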